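{- Let $P(t)$ denote the number of pure $O$-sequences of socle degree $3$ and type $t$ (of any codimension). Then $\displaystyle\lim_{t\to\infty}\frac{P(t)}{t^2}=\frac92$.
   Context: A monomial order ideal is a finite nonempty set of monomials closed under taking divisors; it is pure of type $t$ if it has exactly $t$ maximal monomials under divisibility, all of the same degree $e$ (the socle degree). A pure $O$-sequence is the vector $(h_0,\dots,h_e)$ counting the monomials of each degree in a pure monomial order ideal; its type is $h_e$. Thus pure $O$-sequences of socle degree 3 and type $t$ have the form $(1,r,a,t)$. -}

module Defs where

open import Data.Nat as ℕ using (ℕ; zero; suc; _≟_)
open import Data.Vec using (Vec; sum)
open import Data.Vec.Relation.Binary.Pointwise.Inductive using (Pointwise)
open import Data.List using (List; []; length; filter)
open import Data.List.Membership.Propositional using (_∈_)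
open import Data.List.Relation.Unary.Unique.Propositional using (Unique)
open import Data.Product using (Σ; ∃; _×_; _,_)
open import Function.Bundles using (_⇔_)
open import Relation.Binary.PropositionalEquality using (_≡_; _≢_)
open import Relation.Nullary using (¬_)
open import Data.Integer using (+_)
open import Data.Rational as ℚ using (ℚ)

-- A monomial in n variables x_1..x_n, given by its exponent vector.
Monomial : ℕ → Set
Monomial n = Vec ℕ n

deg : ∀ {n} → Monomial n → ℕ
deg m = sum m

_∣ₘ_ : ∀ {n} → Monomial n → Monomial n → Set
m ∣ₘ m' = Pointwise ℕ._≤_ m m'

record OrderIdeal (n : ℕ) : Set where
  field
    elems    : List (Monomial n)
    unique   : Unique elems
    nonempty : elems ≢ []
    closed   : ∀ {m m'} → m ∈ elems → m' ∣ₘ m → m' ∈ elems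
open OrderIdeal public

IsMaximal : ∀ {n} → OrderIdeal n → Monomial n → Set
IsMaximal S m = (m ∈ elems S) × (∀ {m'} → m' ∈ elems S → m ∣ₘ m' → m' ≡ m)

IsPure : ∀ {n} → OrderIdeal n → (t e : ℕ) → Set
IsPure S t e =
  Σ (List (Monomial _)) λ M →
    Unique M × length M ≡ t ×
    (∀ m → m ∈ M ⇔ IsMaximal S m) ×
    (∀ {m} → m ∈ M → deg m ≡ e)

h : ∀ {n} → OrderIdeal n → ℕ → ℕ
h S d = length (filter (λ m → deg m ≟ d) (elems S))

IsPureOSeq3 : (r a t : ℕ) → Set
IsPureOSeq3 r a t =
  ∃ λ n → Σ (OrderIdeal n) λ S →
    IsPure S t 3 × h S 0 ≡ 1 × h S 1 ≡ r × h S 2 ≡ a × h S 3 ≡ t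

Counts : (ℕ → ℕ) → Set
Counts P = ∀ t → Σ (List (ℕ × ℕ)) λ L →
  Unique L × length L ≡ P t ×
  (∀ r a → (r , a) ∈ L ⇔ IsPureOSeq3 r a t)

-- P(t)/t² as a rational, for t = suc k ≥ 1
ratio : (ℕ → ℕ) → ℕ → ℚ
ratio P k = (+ P (suc k)) ℚ./ (suc k ℕ.* suc k)

ConvergesTo : (ℕ → ℚ) → ℚ → Set
ConvergesTo q L = ∀ (ε : ℚ) → ℚ.0ℚ ℚ.< ε →
  ∃ λ N → ∀ k → N ℕ.≤ k → ℚ.∣ q k ℚ.- L ∣ ℚ.< ε

{-# OPTIONS --safe #-}
-- A pure O-sequence (1, r, a, t) satisfies r ≤ a ≤ 3t, so 2 P(t) ≤ (3t + 1)(3t + 2).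
-- For r ≤ a, add the degree 3 generators xyz one at a time and give the variables among x, y, z
-- not seen before the quadratic monomials xy, yz, zx respectively: these are new as well.
-- Conversely, take disjoint unions of
--   * a core in O(t^(1/3)) variables, which absorbs any number of generators without changing (r, a);
--   * a Latin square configuration in O(t^(2/3)) variables, where each generator adds (0, 3) to (r, a);
--   * squarefree generators in three new variables, each of which adds (3, 3);
--   * boundedly many small configurations which adjust residues modulo 3.
-- They realise every (r, a) in a translate by O(t^(2/3)) of the triangle 0 ≤ r ≤ a ≤ 3t - O(t^(2/3)),
-- so |2 P(t) - 9 t²| = O(t^(5/3)).
module Submission where

open import Defs
open import Data.Nat as ℕ using (ℕ; zero; suc; _+_; _*_; _∸_; _≤_; _<_; z≤n; s≤s; s≤s⁻¹; _≟_; _≤?_; _<?_)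
open import Data.Nat.Properties
open import Data.Nat.DivMod using (m≡m%n+[m/n]*n; m%n<n)
open import Data.Nat.Tactic.RingSolver using (solve-∀)
open import Algebra.Properties.CommutativeSemigroup +-commutativeSemigroup using (interchange)
open import Data.Fin as Fin using (Fin; zero; suc; toℕ; fromℕ<; _↑ˡ_; _↑ʳ_; splitAt)
open import Data.Fin.Properties using (toℕ-fromℕ<; toℕ<n; toℕ-injective; splitAt-↑ˡ; splitAt-↑ʳ)
open import Data.Vec as Vec using ([]; _∷_; replicate; zipWith)
open import Data.Vec.Properties using (zipWith-comm; zipWith-assoc; ++-injectiveˡ; ++-injectiveʳ; sum-++)
open import Data.Vec.Relation.Binary.Pointwise.Inductive as PW using ([]; _∷_)
open import Data.List using (List; []; _∷_; length; map; _++_; filter; take; upTo; allFin; cartesianProduct)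
open import Data.List.Membership.Propositional using (_∈_; _∉_)
open import Data.List.Membership.Propositional.Properties
open import Data.List.Properties using (length-map; length-++; length-++-sucʳ; length-take; length-tabulate; length-upTo; filter-all; filter-none; filter-++)
open import Data.List.Relation.Binary.Disjoint.Propositional using (Disjoint)
open import Data.List.Relation.Unary.Any using (here; there; any?)
open import Data.List.Relation.Unary.All as All using (All; []; _∷_)
open import Data.List.Relation.Unary.All.Properties using (¬Any⇒All¬)
open import Data.List.Relation.Unary.AllPairs using ([]; _∷_)
open import Data.List.Relation.Unary.Unique.Propositional using (Unique)
open import Data.List.Relation.Unary.Unique.Propositional.Properties using (map⁺; ++⁺; take⁺; filter⁺; upTo⁺; allFin⁺; cartesianProduct⁺; Unique[x∷xs]⇒x∉xs)
open import Data.Product using (∃; ∃₂; _×_; _,_; proj₁; proj₂)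
open import Data.Sum as Sum using (_⊎_; inj₁; inj₂)
open import Data.Sum.Properties using (inj₁-injective; inj₂-injective)
open import Data.Empty using (⊥-elim)
open import Function using (id)
open import Function.Bundles using (Equivalence; mk⇔)
open import Relation.Nullary using (¬_; Dec; yes; no)
open import Relation.Binary.PropositionalEquality using (_≡_; _≢_; refl; sym; trans; cong; cong₂; subst; subst₂; module ≡-Reasoning)

-- The two bounds meet because a pair costs few generators. With x = r and y = a - r up to
-- constants, a squarefree generator in new variables pays for three units of x and a Latin
-- generator for three units of y, so about (x + y)/3 = a/3 generators suffice, and a ≤ 3t is also
-- the only upper restriction on a. The obstacle is that the type is exactly t: the surplus
-- generators must be placed without creating monomials of degree 1 or 2. The core offers this room
-- since N variables have of order N³ cubic but only of order N² quadratic monomials; making N³ of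
-- order t costs N², of order t^(2/3), and this determines the error. The Latin configuration
-- exploits a similar gap, M² generators on 4M variables. The limit 9/2 is the area of a right
-- triangle with legs 3t, in units of t²; all counts are doubled to avoid division.

-- Lists without repetition

Unique-⊆-length : ∀ {A : Set} {xs ys : List A} → Unique xs → (∀ {x} → x ∈ xs → x ∈ ys) → length xs ≤ length ys
Unique-⊆-length {xs = []}     _ _ = z≤n
Unique-⊆-length {xs = x ∷ xs} {ys} u@(_ ∷ us) xs⊆ys with ∈-∃++ (xs⊆ys (here refl))
... | ps , qs , refl = subst (suc (length xs) ≤_) (sym (length-++-sucʳ ps x qs))
        (s≤s (Unique-⊆-length us λ z∈ → avoid z∈ (∈-++⁻ ps (xs⊆ys (there z∈)))))
  where
  avoid : ∀ {z} → z ∈ xs → z ∈ ps ⊎ z ∈ x ∷ qs → z ∈ ps ++ qs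
  avoid z∈xs (inj₁ z∈ps)         = ∈-++⁺ˡ z∈ps
  avoid z∈xs (inj₂ (here refl))  = ⊥-elim (Unique[x∷xs]⇒x∉xs u z∈xs)
  avoid z∈xs (inj₂ (there z∈qs)) = ∈-++⁺ʳ ps z∈qs

disjoint-++ : ∀ {A : Set} {xs ys zs : List A} → Disjoint xs ys → Disjoint xs zs → Disjoint xs (ys ++ zs)
disjoint-++ {ys = ys} f g (p , q) with ∈-++⁻ ys q
... | inj₁ q₁ = f (p , q₁)
... | inj₂ q₂ = g (p , q₂)

disjoint-map : ∀ {A B C : Set} {f : A → C} {g : B → C} {xs ys} →
               (∀ {x y} → f x ≢ g y) → Disjoint (map f xs) (map g ys)
disjoint-map {f = f} {g} f≢g (p , q) with ∈-map⁻ f p | ∈-map⁻ g q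
... | _ , _ , refl | _ , _ , eq = f≢g eq

∈-take⁻ : ∀ {A : Set} k (xs : List A) {x} → x ∈ take k xs → x ∈ xs
∈-take⁻ (suc k) (y ∷ xs) (here p)  = here p
∈-take⁻ (suc k) (y ∷ xs) (there p) = there (∈-take⁻ k xs p)

length-cartesianProduct : ∀ {A B : Set} (xs : List A) (ys : List B) →
                          length (cartesianProduct xs ys) ≡ length xs * length ys
length-cartesianProduct []       ys = refl
length-cartesianProduct (x ∷ xs) ys =
  trans (length-++ (map (x ,_) ys)) (cong₂ _+_ (length-map (x ,_) ys) (length-cartesianProduct xs ys))

-- Monomials

infixl 21 _⊕_

_⊕_ : ∀ {n} → Monomial n → Monomial n → Monomial n
_⊕_ = zipWith _+_

𝟙 : ∀ {n} → Monomial n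
𝟙 = replicate _ 0

var : ∀ {n} → Fin n → Monomial n
var zero    = 1 ∷ 𝟙
var (suc i) = 0 ∷ var i

∣-refl : ∀ {n} {a : Monomial n} → a ∣ₘ a
∣-refl = PW.refl ≤-refl

∣-trans : ∀ {n} {a b c : Monomial n} → a ∣ₘ b → b ∣ₘ c → a ∣ₘ c
∣-trans = PW.trans ≤-trans

∣-antisym : ∀ {n} {a b : Monomial n} → a ∣ₘ b → b ∣ₘ a → a ≡ b
∣-antisym []       []       = refl
∣-antisym (p ∷ ps) (q ∷ qs) = cong₂ _∷_ (≤-antisym p q) (∣-antisym ps qs)

_∣?_ : ∀ {n} (a b : Monomial n) → Dec (a ∣ₘ b)
_∣?_ = PW.decidable _≤?_

𝟙∣ : ∀ {n} (a : Monomial n) → 𝟙 ∣ₘ a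
𝟙∣ []      = []
𝟙∣ (_ ∷ a) = z≤n ∷ 𝟙∣ a

∣-⊕ʳ : ∀ {n} (a b : Monomial n) → a ∣ₘ a ⊕ b
∣-⊕ʳ []      []      = []
∣-⊕ʳ (x ∷ a) (y ∷ b) = m≤m+n x y ∷ ∣-⊕ʳ a b

⊕-comm : ∀ {n} (a b : Monomial n) → a ⊕ b ≡ b ⊕ a
⊕-comm = zipWith-comm +-comm

⊕-assoc : ∀ {n} (a b c : Monomial n) → (a ⊕ b) ⊕ c ≡ a ⊕ (b ⊕ c)
⊕-assoc = zipWith-assoc +-assoc

∣-⊕ˡ : ∀ {n} (a b : Monomial n) → a ∣ₘ b ⊕ a
∣-⊕ˡ a b = subst (a ∣ₘ_) (⊕-comm a b) (∣-⊕ʳ a b)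

⊕-cancelˡ : ∀ {n} (a b c : Monomial n) → a ⊕ b ≡ a ⊕ c → b ≡ c
⊕-cancelˡ []      []      []      _ = refl
⊕-cancelˡ (x ∷ a) (y ∷ b) (z ∷ c) p =
  cong₂ _∷_ (+-cancelˡ-≡ x y z (cong Vec.head p)) (⊕-cancelˡ a b c (cong Vec.tail p))

∣⇒⊕ : ∀ {n} {a b : Monomial n} → a ∣ₘ b → ∃ λ c → b ≡ a ⊕ c
∣⇒⊕ []       = [] , refl
∣⇒⊕ (p ∷ ps) = let c , eq = ∣⇒⊕ ps in _ ∷ c , cong₂ _∷_ (sym (m+[n∸m]≡n p)) eq

deg-⊕ : ∀ {n} (a b : Monomial n) → deg (a ⊕ b) ≡ deg a + deg b
deg-⊕ []      []      = refl
deg-⊕ (x ∷ a) (y ∷ b) = trans (cong (x + y +_) (deg-⊕ a b)) (interchange x y (deg a) (deg b))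

deg-𝟙 : ∀ n → deg (𝟙 {n}) ≡ 0
deg-𝟙 zero    = refl
deg-𝟙 (suc n) = deg-𝟙 n

deg-var : ∀ {n} (i : Fin n) → deg (var i) ≡ 1
deg-var {suc n} zero    = cong suc (deg-𝟙 n)
deg-var         (suc i) = deg-var i

deg-mono : ∀ {n} {a b : Monomial n} → a ∣ₘ b → deg a ≤ deg b
deg-mono []       = z≤n
deg-mono (p ∷ ps) = +-mono-≤ p (deg-mono ps)

deg≡0⇒𝟙 : ∀ {n} (a : Monomial n) → deg a ≡ 0 → a ≡ 𝟙
deg≡0⇒𝟙 []         _ = refl
deg≡0⇒𝟙 (zero ∷ a) p = cong (0 ∷_) (deg≡0⇒𝟙 a p)

⊕-identityʳ : ∀ {n} (a : Monomial n) → a ⊕ 𝟙 ≡ a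
⊕-identityʳ []      = refl
⊕-identityʳ (x ∷ a) = cong₂ _∷_ (+-identityʳ x) (⊕-identityʳ a)

-- The cofactor has degree 0. Consequently monomials of one degree form an antichain, so that
-- distinct cubic generators are exactly the maximal monomials of the ideal they generate.
∣-deg-≡ : ∀ {n} {a b : Monomial n} → a ∣ₘ b → deg b ≤ deg a → b ≡ a
∣-deg-≡ {a = a} {b} a∣b db≤da with c , refl ← ∣⇒⊕ a∣b =
  trans (cong (a ⊕_) (deg≡0⇒𝟙 c deg-c)) (⊕-identityʳ a)
  where
  deg-c : deg c ≡ 0
  deg-c = +-cancelˡ-≡ (deg a) (deg c) 0
    (trans (≤-antisym (subst (_≤ deg a) (deg-⊕ a c) db≤da) (m≤m+n _ _)) (sym (+-identityʳ _)))

𝟙-⊕ : ∀ {n} (a : Monomial n) → 𝟙 ⊕ a ≡ a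
𝟙-⊕ a = trans (⊕-comm 𝟙 a) (⊕-identityʳ a)

split-var : ∀ {n k} (a : Monomial n) → deg a ≡ suc k → ∃₂ λ i b → a ≡ var i ⊕ b × deg b ≡ k
split-var (zero ∷ a)  p =
  let i , b , eq , q = split-var a p in suc i , 0 ∷ b , cong (0 ∷_) eq , q
split-var (suc x ∷ a) p = zero , x ∷ a , cong (suc x ∷_) (sym (𝟙-⊕ a)) , suc-injective p

deg≡1⇒var : ∀ {n} (a : Monomial n) → deg a ≡ 1 → ∃ λ i → a ≡ var i
deg≡1⇒var a p with i , b , refl , q ← split-var a p =
  i , trans (cong (var i ⊕_) (deg≡0⇒𝟙 b q)) (⊕-identityʳ (var i))

var∤𝟙 : ∀ {n} (i : Fin n) → ¬ (var i ∣ₘ 𝟙)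
var∤𝟙 zero    (() ∷ _)
var∤𝟙 (suc i) (_ ∷ p) = var∤𝟙 i p

-- Primality of the variables replaces computation with exponent vectors: below, products of
-- variables are told apart by the variables that divide them.
var-prime : ∀ {n} (i : Fin n) (a b : Monomial n) → var i ∣ₘ a ⊕ b → var i ∣ₘ a ⊎ var i ∣ₘ b
var-prime zero    (suc x ∷ a) (y ∷ b)     _       = inj₁ (s≤s z≤n ∷ 𝟙∣ a)
var-prime zero    (zero ∷ a)  (suc y ∷ b) _       = inj₂ (s≤s z≤n ∷ 𝟙∣ b)
var-prime zero    (zero ∷ a)  (zero ∷ b)  (() ∷ _)
var-prime (suc i) (x ∷ a)     (y ∷ b)     (_ ∷ p) with var-prime i a b p
... | inj₁ q = inj₁ (z≤n ∷ q)
... | inj₂ q = inj₂ (z≤n ∷ q)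

var∣var : ∀ {n} (i j : Fin n) → var i ∣ₘ var j → i ≡ j
var∣var zero    zero    _       = refl
var∣var zero    (suc j) (() ∷ _)
var∣var (suc i) zero    (_ ∷ p) = ⊥-elim (var∤𝟙 i p)
var∣var (suc i) (suc j) (_ ∷ p) = cong suc (var∣var i j p)

var-injective : ∀ {n} {i j : Fin n} → var i ≡ var j → i ≡ j
var-injective {i = i} {j} p = var∣var i j (subst (var i ∣ₘ_) p ∣-refl)

var²  : ∀ {n} → Fin n → Fin n → Monomial n
var² i j = var i ⊕ var j

var³ : ∀ {n} → Fin n → Fin n → Fin n → Monomial n
var³ i j k = var i ⊕ var² j k

deg-var² : ∀ {n} (i j : Fin n) → deg (var² i j) ≡ 2
deg-var² i j = trans (deg-⊕ (var i) (var j)) (cong₂ _+_ (deg-var i) (deg-var j))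

deg-var³ : ∀ {n} (i j k : Fin n) → deg (var³ i j k) ≡ 3
deg-var³ i j k = trans (deg-⊕ (var i) (var² j k)) (cong₂ _+_ (deg-var i) (deg-var² j k))

var∣var² : ∀ {n} (l i j : Fin n) → var l ∣ₘ var² i j → l ≡ i ⊎ l ≡ j
var∣var² l i j p with var-prime l (var i) (var j) p
... | inj₁ q = inj₁ (var∣var l i q)
... | inj₂ q = inj₂ (var∣var l j q)

var∣var³ : ∀ {n} (l i j k : Fin n) → var l ∣ₘ var³ i j k → l ≡ i ⊎ l ≡ j ⊎ l ≡ k
var∣var³ l i j k p with var-prime l (var i) (var² j k) p
... | inj₁ q = inj₁ (var∣var l i q)
... | inj₂ q = inj₂ (var∣var² l j k q)

var∣square : ∀ {n} (l i : Fin n) → var l ∣ₘ var² i i → l ≡ i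
var∣square l i p = Sum.[ id , id ] (var∣var² l i i p)

var∣cube : ∀ {n} (l i : Fin n) → var l ∣ₘ var³ i i i → l ≡ i
var∣cube l i p = Sum.[ id , Sum.[ id , id ] ] (var∣var³ l i i i p)

⊕-swap : ∀ {n} (a b c : Monomial n) → a ⊕ (b ⊕ c) ≡ b ⊕ (a ⊕ c)
⊕-swap a b c = trans (sym (⊕-assoc a b c)) (trans (cong (_⊕ c) (⊕-comm a b)) (⊕-assoc b a c))

-- The cofactor has degree 1, hence is a variable; by primality it is one of the three factors,
-- which is then cancelled.
var³-deg2-divisor : ∀ {n} (m : Monomial n) (i j k : Fin n) → m ∣ₘ var³ i j k → deg m ≡ 2 →
                    m ≡ var² j k ⊎ m ≡ var² i k ⊎ m ≡ var² i j
var³-deg2-divisor m i j k m∣ dm with ∣⇒⊕ m∣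
... | c , eq with deg≡1⇒var c deg-c
  where
  deg-c : deg c ≡ 1
  deg-c = suc-injective (suc-injective
    (trans (cong (_+ deg c) (sym dm)) (trans (sym (deg-⊕ m c)) (trans (cong deg (sym eq)) (deg-var³ i j k)))))
... | l , refl with eq' ← trans eq (⊕-comm m (var l))
               with var∣var³ l i j k (subst (var l ∣ₘ_) (sym eq') (∣-⊕ʳ (var l) m))
... | inj₁ refl        = inj₁ (⊕-cancelˡ (var l) _ _ (sym eq'))
... | inj₂ (inj₁ refl) = inj₂ (inj₁ (⊕-cancelˡ (var l) _ _ (trans (sym eq') (⊕-swap (var i) (var l) (var k)))))
... | inj₂ (inj₂ refl) = inj₂ (inj₂ (⊕-cancelˡ (var l) _ _ (trans (sym eq')
        (trans (cong (var i ⊕_) (⊕-comm (var j) (var l))) (⊕-swap (var i) (var l) (var j))))))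

jk∣ : ∀ {n} (i j k : Fin n) → var² j k ∣ₘ var³ i j k
jk∣ i j k = ∣-⊕ˡ (var² j k) (var i)

ij∣ : ∀ {n} (i j k : Fin n) → var² i j ∣ₘ var³ i j k
ij∣ i j k = subst (var² i j ∣ₘ_) (⊕-assoc (var i) (var j) (var k)) (∣-⊕ʳ (var² i j) (var k))

ik∣ : ∀ {n} (i j k : Fin n) → var² i k ∣ₘ var³ i j k
ik∣ i j k = subst (var² i k ∣ₘ_) (⊕-swap (var j) (var i) (var k)) (∣-⊕ˡ (var² i k) (var j))

i∣ : ∀ {n} (i j k : Fin n) → var i ∣ₘ var³ i j k
i∣ i j k = ∣-⊕ʳ (var i) _

j∣ : ∀ {n} (i j k : Fin n) → var j ∣ₘ var³ i j k
j∣ i j k = ∣-trans (∣-⊕ʳ (var j) (var k)) (jk∣ i j k)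

k∣ : ∀ {n} (i j k : Fin n) → var k ∣ₘ var³ i j k
k∣ i j k = ∣-trans (∣-⊕ˡ (var k) (var j)) (jk∣ i j k)

-- Upper bound

-- One pass suffices: the candidate only moves up, so an entry that it once failed to divide is not
-- divisible by any later candidate either. The start `m` is kept apart from `xs`, since the
-- candidate is not an entry of the remaining list.
maximal-above : ∀ {n} (xs : List (Monomial n)) (m : Monomial n) →
                ∃ λ m' → m ∣ₘ m' × (m' ≡ m ⊎ m' ∈ xs) × (∀ {x} → x ∈ xs → m' ∣ₘ x → x ≡ m')
maximal-above []       m = m , ∣-refl , inj₁ refl , λ ()
maximal-above (x ∷ xs) m with m ∣? x
... | yes m∣x with maximal-above xs x
...   | m' , x∣m' , m'∈ , max = m' , ∣-trans m∣x x∣m' , inj₂ (tail∈ m'∈) , max'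
  where
  tail∈ : m' ≡ x ⊎ m' ∈ xs → m' ∈ x ∷ xs
  tail∈ (inj₁ p) = here p
  tail∈ (inj₂ p) = there p
  max' : ∀ {z} → z ∈ x ∷ xs → m' ∣ₘ z → z ≡ m'
  max' (here refl) m'∣x = ∣-antisym x∣m' m'∣x
  max' (there z∈)  m'∣z = max z∈ m'∣z
maximal-above (x ∷ xs) m | no m∤x with maximal-above xs m
...   | m' , m∣m' , m'∈ , max = m' , m∣m' , tail∈ m'∈ , max'
  where
  tail∈ : m' ≡ m ⊎ m' ∈ xs → m' ≡ m ⊎ m' ∈ x ∷ xs
  tail∈ (inj₁ p) = inj₁ p
  tail∈ (inj₂ p) = inj₂ (there p)
  max' : ∀ {z} → z ∈ x ∷ xs → m' ∣ₘ z → z ≡ m'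
  max' (here refl) m'∣x = ⊥-elim (m∤x (∣-trans m∣m' m'∣x))
  max' (there z∈)  m'∣z = max z∈ m'∣z

below-maximal : ∀ {n} (S : OrderIdeal n) {m} → m ∈ elems S → ∃ λ m' → IsMaximal S m' × m ∣ₘ m'
below-maximal S {m} m∈ with maximal-above (elems S) m
... | m' , m∣m' , inj₁ refl , max = m' , (m∈ , max) , m∣m'
... | m' , m∣m' , inj₂ m'∈  , max = m' , (m'∈ , max) , m∣m'

-- Injecting the variables into the quadratic monomials

Triple : ℕ → Set
Triple n = Fin n × Fin n × Fin n

⟦_⟧ : ∀ {n} → Triple n → Monomial n
⟦ i , j , k ⟧ = var³ i j k

-- Makes the cyclic assignment i ↦ ij, j ↦ jk, k ↦ ki injective on the set {i, j, k}.
Spread : ∀ {n} → Triple n → Set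
Spread (i , j , k) = i ≡ k → i ≡ j

deg≡3⇒spread : ∀ {n} (m : Monomial n) → deg m ≡ 3 → ∃ λ τ → m ≡ ⟦ τ ⟧ × Spread τ
deg≡3⇒spread m p
  with i , a , refl , q ← split-var m p
  with j , b , refl , r ← split-var a q
  with k , refl ← deg≡1⇒var b r
  with i Fin.≟ k
... | no i≢k = (i , j , k) , refl , λ i≡k → ⊥-elim (i≢k i≡k)
-- The order i, j, i would assign ij to both i and j; the order i, i, j assigns ii to i and ji to j.
... | yes refl = (i , i , j) , cong (var i ⊕_) (⊕-comm (var j) (var i)) , λ _ → refl

-- One step of the matching: if the variable `l` is unseen, it is recorded together with its partner
-- `q`; otherwise nothing changes. The clause `l ∉ V` in `origin` remembers that `q` was added only
-- because `l` was unseen, which a later step of the same generator contradicts.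
record Extension {n} (V : List (Fin n)) (E : List (Monomial n)) (l : Fin n) (q : Monomial n) : Set where
  field
    V⁺       : List (Fin n)
    E⁺       : List (Monomial n)
    mono     : ∀ {i} → i ∈ V → i ∈ V⁺
    new      : l ∈ V⁺
    unique⁺  : Unique E⁺
    origin   : ∀ {q'} → q' ∈ E⁺ → q' ∈ E ⊎ (q' ≡ q × l ∉ V)
    size     : length V⁺ ≤ length E⁺

extend : ∀ {n} (V : List (Fin n)) (E : List (Monomial n)) l q →
         Unique E → length V ≤ length E → (l ∉ V → q ∉ E) → Extension V E l q
extend V E l q uE V≤E fresh with any? (l Fin.≟_) V
... | yes l∈V = record { V⁺ = V ; E⁺ = E ; mono = λ p → p ; new = l∈V ; unique⁺ = uE ; origin = inj₁ ; size = V≤E }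
... | no  l∉V = record { V⁺ = l ∷ V ; E⁺ = q ∷ E ; mono = there ; new = here refl
                       ; unique⁺ = ¬Any⇒All¬ E (fresh l∉V) ∷ uE ; origin = origin′ ; size = s≤s V≤E }
  where
  origin′ : ∀ {q'} → q' ∈ q ∷ E → q' ∈ E ⊎ (q' ≡ q × l ∉ V)
  origin′ (here refl) = inj₂ (refl , l∉V)
  origin′ (there p)   = inj₁ p

-- The invariant that drives the induction is `support`: the chosen quadratic monomials involve seen
-- variables only, so a monomial with an unseen variable cannot be among them. Injectivity of the
-- assignment appears only as `unique′` together with `size`.
record Matching {n} (G : List (Triple n)) : Set where
  field
    vars    : List (Fin n)
    pairs   : List (Monomial n)
    unique′ : Unique pairs
    covers  : ∀ {τ l} → τ ∈ G → var l ∣ₘ ⟦ τ ⟧ → l ∈ vars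
    within  : ∀ {q} → q ∈ pairs → deg q ≡ 2 × ∃ λ τ → τ ∈ G × q ∣ₘ ⟦ τ ⟧
    support : ∀ {q l} → q ∈ pairs → var l ∣ₘ q → l ∈ vars
    size    : length vars ≤ length pairs

matching : ∀ {n} (G : List (Triple n)) → All Spread G → Matching G
matching [] [] = record
  { vars = [] ; pairs = [] ; unique′ = [] ; covers = λ () ; within = λ () ; support = λ () ; size = z≤n }
matching (τ@(x , y , z) ∷ G) (spread ∷ spreads) = record
  { vars = V₃ ; pairs = E₃ ; unique′ = S₃.unique⁺ ; covers = covers′ ; within = λ p → within′ (origin p)
  ; support = λ p → support′ (origin p) ; size = S₃.size }
  where
  open Matching (matching G spreads)

  module S₁ = Extension (extend vars pairs x (var² x y) unique′ size
    (λ x∉ xy∈ → x∉ (support xy∈ (∣-⊕ʳ (var x) (var y)))))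

  -- Older pairs are excluded by `support`. A clash with the xy just added would give z = x, hence x
  -- = y by spreadness, and then y has been seen already.
  fresh₂ : y ∉ S₁.V⁺ → var² y z ∉ S₁.E⁺
  fresh₂ y∉ yz∈ with S₁.origin yz∈
  ... | inj₁ old      = y∉ (S₁.mono (support old (∣-⊕ʳ (var y) (var z))))
  ... | inj₂ (eq , _) = y∉ (subst (_∈ S₁.V⁺) (spread (sym z≡x)) S₁.new)
    where
    z≡x : z ≡ x
    z≡x = var-injective (⊕-cancelˡ (var y) _ _ (trans eq (⊕-comm (var x) (var y))))

  module S₂ = Extension (extend S₁.V⁺ S₁.E⁺ y (var² y z) S₁.unique⁺ S₁.size fresh₂)

  -- A clash with yz gives x = y, although yz was added only because y was unseen after x; a clash
  -- with xy gives z = y, which has been seen.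
  fresh₃ : z ∉ S₂.V⁺ → var² z x ∉ S₂.E⁺
  fresh₃ z∉ zx∈ with S₂.origin zx∈
  ... | inj₂ (eq , y∉) = y∉ (subst (_∈ S₁.V⁺) x≡y S₁.new)
    where
    x≡y : x ≡ y
    x≡y = var-injective (⊕-cancelˡ (var z) _ _ (trans eq (⊕-comm (var y) (var z))))
  ... | inj₁ p with S₁.origin p
  ...   | inj₁ old      = z∉ (S₂.mono (S₁.mono (support old (∣-⊕ʳ (var z) (var x)))))
  ...   | inj₂ (eq , _) = z∉ (subst (_∈ S₂.V⁺) (sym z≡y) S₂.new)
    where
    z≡y : z ≡ y
    z≡y = var-injective (⊕-cancelˡ (var x) _ _ (trans (⊕-comm (var x) (var z)) eq))

  module S₃ = Extension (extend S₂.V⁺ S₂.E⁺ z (var² z x) S₂.unique⁺ S₂.size fresh₃)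

  V₃ : List (Fin _)
  V₃ = S₃.V⁺

  E₃ : List (Monomial _)
  E₃ = S₃.E⁺

  old⊆ : ∀ {l} → l ∈ vars → l ∈ V₃
  old⊆ p = S₃.mono (S₂.mono (S₁.mono p))

  x∈ : x ∈ V₃
  x∈ = S₃.mono (S₂.mono S₁.new)

  y∈ : y ∈ V₃
  y∈ = S₃.mono S₂.new

  new⊆ : ∀ {l} → var l ∣ₘ ⟦ τ ⟧ → l ∈ V₃
  new⊆ {l} p with var∣var³ l x y z p
  ... | inj₁ refl        = x∈
  ... | inj₂ (inj₁ refl) = y∈
  ... | inj₂ (inj₂ refl) = S₃.new

  origin : ∀ {q} → q ∈ E₃ → q ∈ pairs ⊎ (deg q ≡ 2 × q ∣ₘ ⟦ τ ⟧)
  origin q∈ with S₃.origin q∈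
  ... | inj₂ (refl , _) = inj₂ (deg-var² z x , subst (_∣ₘ ⟦ τ ⟧) (⊕-comm (var x) (var z)) (ik∣ x y z))
  ... | inj₁ p with S₂.origin p
  ...   | inj₂ (refl , _) = inj₂ (deg-var² y z , jk∣ x y z)
  ...   | inj₁ p' with S₁.origin p'
  ...     | inj₂ (refl , _) = inj₂ (deg-var² x y , ij∣ x y z)
  ...     | inj₁ old        = inj₁ old

  covers′ : ∀ {τ' l} → τ' ∈ τ ∷ G → var l ∣ₘ ⟦ τ' ⟧ → l ∈ V₃
  covers′ (here refl) p = new⊆ p
  covers′ (there τ'∈) p = old⊆ (covers τ'∈ p)

  within′ : ∀ {q} → q ∈ pairs ⊎ (deg q ≡ 2 × q ∣ₘ ⟦ τ ⟧) → deg q ≡ 2 × ∃ λ τ' → τ' ∈ τ ∷ G × q ∣ₘ ⟦ τ' ⟧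
  within′ (inj₁ old)      = let d , τ' , τ'∈ , q∣ = within old in d , τ' , there τ'∈ , q∣
  within′ (inj₂ (d , q∣)) = d , τ , here refl , q∣

  support′ : ∀ {q l} → q ∈ pairs ⊎ (deg q ≡ 2 × q ∣ₘ ⟦ τ ⟧) → var l ∣ₘ q → l ∈ V₃
  support′ (inj₁ old)      l∣q = old⊆ (support old l∣q)
  support′ (inj₂ (_ , q∣)) l∣q = new⊆ (∣-trans l∣q q∣)

triples : ∀ {n} (M : List (Monomial n)) → (∀ {m} → m ∈ M → deg m ≡ 3) →
          ∃ λ G → map ⟦_⟧ G ≡ M × All Spread G
triples []      _ = [] , refl , []
triples (m ∷ M) d =
  let τ , m≡τ , s = deg≡3⇒spread m (d (here refl))
      G , G≡M , ss = triples M (λ p → d (there p))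
  in τ ∷ G , cong₂ _∷_ (sym m≡τ) G≡M , s ∷ ss

-- Repetitions are kept: the list serves as an upper bound, and only its length `3 * length G`
-- matters.
edges : ∀ {n} → List (Triple n) → List (Monomial n)
edges []                = []
edges ((i , j , k) ∷ G) = var² j k ∷ var² i k ∷ var² i j ∷ edges G

length-edges : ∀ {n} (G : List (Triple n)) → length (edges G) ≡ 3 * length G
length-edges []      = refl
length-edges (_ ∷ G) = trans (cong (3 +_) (length-edges G)) (sym (*-suc 3 (length G)))

∈-edges : ∀ {n} {G : List (Triple n)} {τ m} → τ ∈ G → m ∣ₘ ⟦ τ ⟧ → deg m ≡ 2 → m ∈ edges G
∈-edges {τ = i , j , k} {m} (here refl) m∣ d with var³-deg2-divisor m i j k m∣ d
... | inj₁ eq        = here eq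
... | inj₂ (inj₁ eq) = there (here eq)
... | inj₂ (inj₂ eq) = there (there (here eq))
∈-edges (there τ∈) m∣ d = there (there (there (∈-edges τ∈ m∣ d)))

∈-map-⟦⟧ : ∀ {n} {G : List (Triple n)} {m} → m ∈ map ⟦_⟧ G → ∃ λ τ → τ ∈ G × m ≡ ⟦ τ ⟧
∈-map-⟦⟧ = ∈-map⁻ ⟦_⟧

-- Purity puts every monomial below a cubic generator. So quadratic monomials occur in `edges G`,
-- variables in the `vars` of the matching, and the partners of the variables belong to the ideal.
OSeq3-bounds : ∀ {r a t} → IsPureOSeq3 r a t → r ≤ a × a ≤ 3 * t
OSeq3-bounds {r} {a} {t} (n , S , (M , uM , lenM , M⇔ , degM) , _ , refl , refl , _)
  with G , refl , spreads ← triples M degM = r≤a , a≤3t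
  where
  open Matching (matching G spreads)

  level : ℕ → List (Monomial n)
  level d = filter (λ m → deg m ≟ d) (elems S)

  unique-level : ∀ d → Unique (level d)
  unique-level d = filter⁺ (λ m → deg m ≟ d) (unique S)

  above : ∀ {d m} → m ∈ level d → ∃ λ τ → τ ∈ G × m ∣ₘ ⟦ τ ⟧ × deg m ≡ d
  above {d} m∈ with ∈-filter⁻ (λ m → deg m ≟ d) {xs = elems S} m∈
  ... | m∈S , dm with below-maximal S m∈S
  ...   | m' , max , m∣m' with ∈-map-⟦⟧ (Equivalence.from (M⇔ m') max)
  ...     | τ , τ∈ , refl = τ , τ∈ , m∣m' , dm

  τ∈S : ∀ {τ} → τ ∈ G → ⟦ τ ⟧ ∈ elems S
  τ∈S τ∈ = proj₁ (Equivalence.to (M⇔ _) (∈-map⁺ ⟦_⟧ τ∈))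

  a≤3t : h S 2 ≤ 3 * t
  a≤3t = ≤-trans (Unique-⊆-length (unique-level 2) (λ m∈ → let _ , τ∈ , m∣ , d = above m∈ in ∈-edges τ∈ m∣ d))
    (≤-reflexive (trans (length-edges G) (cong (3 *_) (trans (sym (length-map ⟦_⟧ G)) lenM))))

  h₁⊆ : ∀ {m} → m ∈ level 1 → m ∈ map var vars
  h₁⊆ {m} m∈ with above m∈
  ... | τ , τ∈ , m∣ , d with deg≡1⇒var m d
  ...   | l , refl = ∈-map⁺ var (covers τ∈ m∣)

  ⊆h₂ : ∀ {q} → q ∈ pairs → q ∈ level 2
  ⊆h₂ q∈ = let d , τ , τ∈ , q∣ = within q∈ in ∈-filter⁺ (λ m → deg m ≟ 2) (closed S (τ∈S τ∈) q∣) d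

  r≤a : h S 1 ≤ h S 2
  r≤a = ≤-trans (Unique-⊆-length (unique-level 1) h₁⊆)
    (≤-trans (≤-reflexive (length-map var vars)) (≤-trans size (Unique-⊆-length unique′ ⊆h₂)))

-- Disjoint unions

-- `L` lists the degree d divisors of the generators `T`. In particular `IsLevel T 3 T` says that
-- `T` consists of distinct cubic monomials.
record IsLevel {n} (T : List (Monomial n)) (d : ℕ) (L : List (Monomial n)) : Set where
  field
    unique-level : Unique L
    sound        : ∀ {m} → m ∈ L → deg m ≡ d × ∃ λ τ → τ ∈ T × m ∣ₘ τ
    complete     : ∀ {m τ} → τ ∈ T → m ∣ₘ τ → deg m ≡ d → m ∈ L

-- Unlike an order ideal it may be empty (t = 0), which makes disjoint unions easy to iterate.
record Configuration (r a t : ℕ) : Set where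
  field
    {dim}   : ℕ
    {T Q V} : List (Monomial dim)
    level₃  : IsLevel T 3 T
    level₂  : IsLevel T 2 Q
    level₁  : IsLevel T 1 V
    size₃   : length T ≡ t
    size₂   : length Q ≡ a
    size₁   : length V ≡ r

generators-level : ∀ {n} {T : List (Monomial n)} → Unique T → (∀ {m} → m ∈ T → deg m ≡ 3) → IsLevel T 3 T
generators-level {T = T} u d = record
  { unique-level = u
  ; sound        = λ m∈ → d m∈ , _ , m∈ , ∣-refl
  ; complete     = λ τ∈ m∣τ dm → subst (_∈ T) (∣-deg-≡ m∣τ (≤-reflexive (trans (d τ∈) (sym dm)))) τ∈
  }

-- The type is a successor because the ideal contains the monomial 1, which has to divide some
-- generator: `τ₀` below.
realise : ∀ {r a t} → Configuration r a (suc t) → IsPureOSeq3 r a (suc t)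
realise record { T = [] ; size₃ = () }
realise {r} {a} {t} record { dim = n ; T = T@(τ₀ ∷ _) ; Q = Q ; V = V ; level₃ = level₃ ; level₂ = level₂ ; level₁ = level₁
        ; size₃ = size₃ ; size₂ = size₂ ; size₁ = size₁ } =
  n , S , (T , L₃.unique-level , size₃ , (λ m → mk⇔ to from) , (λ m∈ → proj₁ (L₃.sound m∈))) ,
  h₀ , trans h₁ size₁ , trans h₂ size₂ , trans h₃ size₃
  where
  module L₁ = IsLevel level₁
  module L₂ = IsLevel level₂
  module L₃ = IsLevel level₃

  level₀ : IsLevel T 0 (𝟙 ∷ [])
  level₀ = record
    { unique-level = [] ∷ []
    ; sound        = λ { (here refl) → deg-𝟙 n , τ₀ , here refl , 𝟙∣ τ₀ }
    ; complete     = λ {m} _ _ d → here (deg≡0⇒𝟙 m d)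
    }

  module L₀ = IsLevel level₀

  E : List (Monomial n)
  E = T ++ Q ++ V ++ 𝟙 ∷ []

  below : ∀ {m} → m ∈ E → ∃ λ τ → τ ∈ T × m ∣ₘ τ
  below m∈ with ∈-++⁻ T m∈
  ... | inj₁ p = proj₂ (L₃.sound p)
  ... | inj₂ m∈′ with ∈-++⁻ Q m∈′
  ...   | inj₁ p = proj₂ (L₂.sound p)
  ...   | inj₂ m∈″ with ∈-++⁻ V m∈″
  ...     | inj₁ p = proj₂ (L₁.sound p)
  ...     | inj₂ p = proj₂ (L₀.sound p)

  by-degree : ∀ {m τ} d → deg m ≡ d → d ≤ 3 → τ ∈ T → m ∣ₘ τ → m ∈ E
  by-degree 0 dm _ τ∈ m∣τ = ∈-++⁺ʳ T (∈-++⁺ʳ Q (∈-++⁺ʳ V (L₀.complete τ∈ m∣τ dm)))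
  by-degree 1 dm _ τ∈ m∣τ = ∈-++⁺ʳ T (∈-++⁺ʳ Q (∈-++⁺ˡ (L₁.complete τ∈ m∣τ dm)))
  by-degree 2 dm _ τ∈ m∣τ = ∈-++⁺ʳ T (∈-++⁺ˡ (L₂.complete τ∈ m∣τ dm))
  by-degree 3 dm _ τ∈ m∣τ = ∈-++⁺ˡ (L₃.complete τ∈ m∣τ dm)
  by-degree (suc (suc (suc (suc d)))) _ (s≤s (s≤s (s≤s ()))) _ _

  closed′ : ∀ {m m'} → m ∈ E → m' ∣ₘ m → m' ∈ E
  closed′ m∈ m'∣m with τ , τ∈ , m∣τ ← below m∈ =
    by-degree _ refl (subst (_ ≤_) (proj₁ (L₃.sound τ∈)) (deg-mono m'∣τ)) τ∈ m'∣τ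
    where m'∣τ = ∣-trans m'∣m m∣τ

  disjoint : ∀ {d d' L L'} → d ≢ d' → (∀ {m} → m ∈ L → deg m ≡ d) → (∀ {m} → m ∈ L' → deg m ≡ d') →
             Disjoint {A = Monomial n} L L'
  disjoint d≢d' f g (p , q) = d≢d' (trans (sym (f p)) (g q))

  deg₃ : ∀ {m} → m ∈ T → deg m ≡ 3
  deg₃ p = proj₁ (L₃.sound p)

  deg₂ : ∀ {m} → m ∈ Q → deg m ≡ 2
  deg₂ p = proj₁ (L₂.sound p)

  deg₁ : ∀ {m} → m ∈ V → deg m ≡ 1
  deg₁ p = proj₁ (L₁.sound p)

  deg₀ : ∀ {m} → m ∈ 𝟙 ∷ [] → deg m ≡ 0
  deg₀ p = proj₁ (L₀.sound p)

  unique-E : Unique E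
  unique-E = ++⁺ L₃.unique-level
    (++⁺ L₂.unique-level (++⁺ L₁.unique-level L₀.unique-level (disjoint (λ ()) deg₁ deg₀))
      (disjoint-++ (disjoint (λ ()) deg₂ deg₁) (disjoint (λ ()) deg₂ deg₀)))
    (disjoint-++ (disjoint (λ ()) deg₃ deg₂) (disjoint-++ (disjoint (λ ()) deg₃ deg₁) (disjoint (λ ()) deg₃ deg₀)))

  S : OrderIdeal n
  S = record { elems = E ; unique = unique-E ; nonempty = λ () ; closed = closed′ }

  to : ∀ {m} → m ∈ T → IsMaximal S m
  to {m} m∈ = ∈-++⁺ˡ m∈ , λ m'∈ m∣m' → let τ , τ∈ , m'∣τ = below m'∈ in
    ∣-deg-≡ m∣m' (≤-trans (deg-mono m'∣τ) (≤-reflexive (trans (deg₃ τ∈) (sym (deg₃ m∈)))))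

  from : ∀ {m} → IsMaximal S m → m ∈ T
  from (m∈ , max) with τ , τ∈ , m∣τ ← below m∈ = subst (_∈ T) (max (∈-++⁺ˡ τ∈) m∣τ) τ∈

  count : ℕ → List (Monomial n) → ℕ
  count d L = length (filter (λ m → deg m ≟ d) L)

  count-++ : ∀ d L L' → count d (L ++ L') ≡ count d L + count d L'
  count-++ d L L' = trans (cong length (filter-++ (λ m → deg m ≟ d) L L')) (length-++ (filter (λ m → deg m ≟ d) L))

  count-E : ∀ d → count d E ≡ count d T + (count d Q + (count d V + count d (𝟙 ∷ [])))
  count-E d = trans (count-++ d T _) (cong (count d T +_) (trans (count-++ d Q _) (cong (count d Q +_) (count-++ d V _))))

  all : ∀ d {L} → (∀ {m} → m ∈ L → deg m ≡ d) → count d L ≡ length L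
  all d f = cong length (filter-all (λ m → deg m ≟ d) (All.tabulate f))

  none : ∀ d {d' L} → d' ≢ d → (∀ {m} → m ∈ L → deg m ≡ d') → count d L ≡ 0
  none d d'≢d f = cong length (filter-none (λ m → deg m ≟ d) (All.tabulate λ p q → d'≢d (trans (sym (f p)) q)))

  h₀ : count 0 E ≡ 1
  h₀ = trans (count-E 0) (cong₂ _+_ (none 0 (λ ()) deg₃) (cong₂ _+_ (none 0 (λ ()) deg₂) (cong₂ _+_ (none 0 (λ ()) deg₁) (all 0 deg₀))))

  h₁ : count 1 E ≡ length V
  h₁ = trans (count-E 1) (trans (cong₂ _+_ (none 1 (λ ()) deg₃) (cong₂ _+_ (none 1 (λ ()) deg₂) (cong₂ _+_ (all 1 deg₁) (none 1 (λ ()) deg₀)))) (+-identityʳ _))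

  h₂ : count 2 E ≡ length Q
  h₂ = trans (count-E 2) (trans (cong₂ _+_ (none 2 (λ ()) deg₃) (cong₂ _+_ (all 2 deg₂) (cong₂ _+_ (none 2 (λ ()) deg₁) (none 2 (λ ()) deg₀)))) (+-identityʳ _))

  h₃ : count 3 E ≡ length T
  h₃ = trans (count-E 3) (trans (cong₂ _+_ (all 3 deg₃) (cong₂ _+_ (none 3 (λ ()) deg₂) (cong₂ _+_ (none 3 (λ ()) deg₁) (none 3 (λ ()) deg₀)))) (+-identityʳ _))

-- Juxtaposing two sets of variables

padʳ : ∀ {m} n → Monomial m → Monomial (m + n)
padʳ n v = v Vec.++ 𝟙 {n}

padˡ : ∀ m {n} → Monomial n → Monomial (m + n)
padˡ m v = 𝟙 {m} Vec.++ v

deg-padʳ : ∀ {m} n (v : Monomial m) → deg (padʳ n v) ≡ deg v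
deg-padʳ n v = trans (sum-++ v) (trans (cong (deg v +_) (deg-𝟙 n)) (+-identityʳ _))

deg-padˡ : ∀ m {n} (v : Monomial n) → deg (padˡ m v) ≡ deg v
deg-padˡ m v = trans (sum-++ (𝟙 {m})) (cong (_+ deg v) (deg-𝟙 m))

∣𝟙⇒𝟙 : ∀ {n} {v : Monomial n} → v ∣ₘ 𝟙 → v ≡ 𝟙
∣𝟙⇒𝟙 {v = v} p = ∣-antisym p (𝟙∣ v)

∣-padʳ⁻ : ∀ {m n} {w : Monomial (m + n)} {v : Monomial m} → w ∣ₘ padʳ n v → ∃ λ u → w ≡ padʳ n u × u ∣ₘ v
∣-padʳ⁻ {m} {w = w} {v} p with w₁ , w₂ , refl ← Vec.splitAt m w =
  let p₁ , p₂ = PW.++⁻ w₁ v p in w₁ , cong (w₁ Vec.++_) (∣𝟙⇒𝟙 p₂) , p₁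

∣-padˡ⁻ : ∀ {m n} {w : Monomial (m + n)} {v : Monomial n} → w ∣ₘ padˡ m v → ∃ λ u → w ≡ padˡ m u × u ∣ₘ v
∣-padˡ⁻ {m} {w = w} p with w₁ , w₂ , refl ← Vec.splitAt m w =
  let p₁ , p₂ = PW.++⁻ w₁ (𝟙 {m}) p in w₂ , cong (Vec._++ w₂) (∣𝟙⇒𝟙 p₁) , p₂

_⊔_ : ∀ {m n} → List (Monomial m) → List (Monomial n) → List (Monomial (m + n))
_⊔_ {m} {n} L L' = map (padʳ n) L ++ map (padˡ m) L'

length-⊔ : ∀ {m n} (L : List (Monomial m)) (L' : List (Monomial n)) → length (L ⊔ L') ≡ length L + length L'
length-⊔ {m} {n} L L' = trans (length-++ (map (padʳ n) L)) (cong₂ _+_ (length-map (padʳ n) L) (length-map (padˡ m) L'))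

∈-⊔⁻ : ∀ {m n} (L : List (Monomial m)) (L' : List (Monomial n)) {w} → w ∈ L ⊔ L' →
       (∃ λ v → v ∈ L × w ≡ padʳ n v) ⊎ (∃ λ v → v ∈ L' × w ≡ padˡ m v)
∈-⊔⁻ {m} {n} L L' w∈ with ∈-++⁻ (map (padʳ n) L) w∈
... | inj₁ p = inj₁ (∈-map⁻ (padʳ n) p)
... | inj₂ p = inj₂ (∈-map⁻ (padˡ m) p)

-- A divisor of a monomial supported on one block is supported on that block. The degree is positive
-- because 1 is the only monomial supported on both blocks.
⊔-level : ∀ {m n d} {T L : List (Monomial m)} {T' L' : List (Monomial n)} →
          IsLevel T (suc d) L → IsLevel T' (suc d) L' → IsLevel (T ⊔ T') (suc d) (L ⊔ L')
⊔-level {m} {n} {d} {T} {L} {T'} {L'} ℒ ℒ' = record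
  { unique-level = ++⁺ (map⁺ (λ {v} {v'} → ++-injectiveˡ v v') A.unique-level)
                       (map⁺ (λ {v} {v'} → ++-injectiveʳ (𝟙 {m}) 𝟙) B.unique-level) disjoint
  ; sound = sound′
  ; complete = complete′
  }
  where
  module A = IsLevel ℒ
  module B = IsLevel ℒ'

  disjoint : Disjoint (map (padʳ n) L) (map (padˡ m) L')
  disjoint (p , q) with ∈-map⁻ (padʳ n) p | ∈-map⁻ (padˡ m) q
  ... | v , v∈ , refl | v' , v'∈ , eq =
    1+n≢0 (trans (sym (proj₁ (A.sound v∈))) (trans (cong deg (++-injectiveˡ v 𝟙 eq)) (deg-𝟙 m)))

  sound′ : ∀ {w} → w ∈ L ⊔ L' → deg w ≡ suc d × ∃ λ τ → τ ∈ T ⊔ T' × w ∣ₘ τ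
  sound′ w∈ with ∈-⊔⁻ L L' w∈
  ... | inj₁ (v , v∈ , refl) = let dv , τ , τ∈ , v∣τ = A.sound v∈ in
    trans (deg-padʳ n v) dv , padʳ n τ , ∈-++⁺ˡ (∈-map⁺ (padʳ n) τ∈) , PW.++⁺ v∣τ ∣-refl
  ... | inj₂ (v , v∈ , refl) = let dv , τ , τ∈ , v∣τ = B.sound v∈ in
    trans (deg-padˡ m v) dv , padˡ m τ , ∈-++⁺ʳ (map (padʳ n) T) (∈-map⁺ (padˡ m) τ∈) , PW.++⁺ (∣-refl {a = 𝟙 {m}}) v∣τ

  complete′ : ∀ {w τ} → τ ∈ T ⊔ T' → w ∣ₘ τ → deg w ≡ suc d → w ∈ L ⊔ L'
  complete′ τ∈ w∣τ dw with ∈-⊔⁻ T T' τ∈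
  ... | inj₁ (v , v∈ , refl) with u , refl , u∣v ← ∣-padʳ⁻ {m} {n} {v = v} w∣τ =
    ∈-++⁺ˡ (∈-map⁺ (padʳ n) (A.complete v∈ u∣v (trans (sym (deg-padʳ n u)) dw)))
  ... | inj₂ (v , v∈ , refl) with u , refl , u∣v ← ∣-padˡ⁻ {m} {n} {v = v} w∣τ =
    ∈-++⁺ʳ (map (padʳ n) L) (∈-map⁺ (padˡ m) (B.complete v∈ u∣v (trans (sym (deg-padˡ m u)) dw)))

infixr 6 _⊞_

_⊞_ : ∀ {r a t r' a' t'} → Configuration r a t → Configuration r' a' t' →
      Configuration (r + r') (a + a') (t + t')
C ⊞ D = record
  { level₃ = ⊔-level C.level₃ D.level₃
  ; level₂ = ⊔-level C.level₂ D.level₂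
  ; level₁ = ⊔-level C.level₁ D.level₁
  ; size₃  = trans (length-⊔ C.T D.T) (cong₂ _+_ C.size₃ D.size₃)
  ; size₂  = trans (length-⊔ C.Q D.Q) (cong₂ _+_ C.size₂ D.size₂)
  ; size₁  = trans (length-⊔ C.V D.V) (cong₂ _+_ C.size₁ D.size₁)
  }
  where
  module C = Configuration C
  module D = Configuration D

empty : Configuration 0 0 0
empty = record { dim = 0 ; level₃ = none ; level₂ = none ; level₁ = none ; size₃ = refl ; size₂ = refl ; size₁ = refl }
  where
  none : ∀ {d} → IsLevel {0} [] d []
  none = record { unique-level = [] ; sound = λ () ; complete = λ () }

copies : ∀ {r a t} k → Configuration r a t → Configuration (k * r) (k * a) (k * t)
copies zero    _ = empty
copies (suc k) C = C ⊞ copies k C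

squarefree-triple : Configuration 3 3 1
squarefree-triple = record
  { T = τ ∷ []
  ; Q = var² j k ∷ var² i k ∷ var² i j ∷ []
  ; V = map var (allFin 3)
  ; level₃ = generators-level ([] ∷ []) (λ { (here refl) → refl })
  ; level₂ = record
    { unique-level = ((λ ()) ∷ (λ ()) ∷ []) ∷ ((λ ()) ∷ []) ∷ [] ∷ []
    ; sound = λ { (here refl) → refl , τ , here refl , jk∣ i j k
                ; (there (here refl)) → refl , τ , here refl , ik∣ i j k
                ; (there (there (here refl))) → refl , τ , here refl , ij∣ i j k }
    ; complete = λ { {m} (here refl) m∣τ d → pair (var³-deg2-divisor m i j k m∣τ d) }
    }
  ; level₁ = record
    { unique-level = map⁺ var-injective (allFin⁺ 3)
    ; sound = λ { (here refl) → refl , τ , here refl , i∣ i j k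
                ; (there (here refl)) → refl , τ , here refl , j∣ i j k
                ; (there (there (here refl))) → refl , τ , here refl , k∣ i j k }
    ; complete = λ {m} _ _ d → unit-vector (deg≡1⇒var m d)
    }
  ; size₃ = refl ; size₂ = refl ; size₁ = refl
  }
  where
  i j k : Fin 3
  i = zero
  j = suc zero
  k = suc (suc zero)

  τ : Monomial 3
  τ = var³ i j k

  pair : ∀ {m} → m ≡ var² j k ⊎ m ≡ var² i k ⊎ m ≡ var² i j → m ∈ var² j k ∷ var² i k ∷ var² i j ∷ []
  pair (inj₁ p)        = here p
  pair (inj₂ (inj₁ p)) = there (here p)
  pair (inj₂ (inj₂ p)) = there (there (here p))

  unit-vector : ∀ {m} → (∃ λ l → m ≡ var l) → m ∈ map var (allFin 3)
  unit-vector (l , refl) = ∈-map⁺ var (∈-allFin l)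

-- Extremal configurations

x₀· : ∀ {n} → Monomial (suc n) → Monomial (suc n)
x₀· (x ∷ v) = suc x ∷ v

x₀·-injective : ∀ {n} {v w : Monomial (suc n)} → x₀· v ≡ x₀· w → v ≡ w
x₀·-injective {v = _ ∷ _} {_ ∷ _} p = cong₂ _∷_ (suc-injective (cong Vec.head p)) (cong Vec.tail p)

deg-x₀· : ∀ {n} (v : Monomial (suc n)) → deg (x₀· v) ≡ suc (deg v)
deg-x₀· (_ ∷ _) = refl

∣-x₀· : ∀ {n} (v : Monomial (suc n)) → v ∣ₘ x₀· v
∣-x₀· (x ∷ v) = n≤1+n x ∷ ∣-refl

-- Split by divisibility by the first variable: this is Pascal's recursion, and it isolates the
-- multiples of x₀ used by the core.
monomials : ∀ (n d : ℕ) → List (Monomial n)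
monomials n       zero    = 𝟙 ∷ []
monomials zero    (suc d) = []
monomials (suc n) (suc d) = map x₀· (monomials (suc n) d) ++ map (0 ∷_) (monomials n (suc d))

x₀·-disjoint : ∀ {n} {L : List (Monomial (suc n))} {L' : List (Monomial n)} → Disjoint (map x₀· L) (map (0 ∷_) L')
x₀·-disjoint (p , q) with ∈-map⁻ x₀· p | ∈-map⁻ (0 ∷_) q
... | (_ ∷ _) , _ , refl | _ , _ , ()

0∷-injective : ∀ {n} {v w : Monomial n} → (0 Vec.∷ v) ≡ 0 ∷ w → v ≡ w
0∷-injective refl = refl

monomials-unique : ∀ n d → Unique (monomials n d)
monomials-unique n       zero    = [] ∷ []
monomials-unique zero    (suc d) = []
monomials-unique (suc n) (suc d) = ++⁺ (map⁺ x₀·-injective (monomials-unique (suc n) d))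
  (map⁺ 0∷-injective (monomials-unique n (suc d))) x₀·-disjoint

∈-monomials⁻ : ∀ n d {v} → v ∈ monomials n d → deg v ≡ d
∈-monomials⁻ n       zero    (here refl) = deg-𝟙 n
∈-monomials⁻ (suc n) (suc d) v∈ with ∈-++⁻ (map x₀· (monomials (suc n) d)) v∈
... | inj₁ p with w , w∈ , refl ← ∈-map⁻ x₀· p = trans (deg-x₀· w) (cong suc (∈-monomials⁻ (suc n) d w∈))
... | inj₂ p with w , w∈ , refl ← ∈-map⁻ (0 ∷_) p = ∈-monomials⁻ n (suc d) w∈

∈-monomials⁺ : ∀ n d v → deg v ≡ d → v ∈ monomials n d
∈-monomials⁺ n       zero    v           p = here (deg≡0⇒𝟙 v p)
∈-monomials⁺ (suc n) (suc d) (suc x ∷ v) p =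
  ∈-++⁺ˡ (∈-map⁺ x₀· (∈-monomials⁺ (suc n) d (x ∷ v) (suc-injective p)))
∈-monomials⁺ (suc n) (suc d) (zero ∷ v)  p =
  ∈-++⁺ʳ (map x₀· (monomials (suc n) d)) (∈-map⁺ (0 ∷_) (∈-monomials⁺ n (suc d) v p))

#monomials : ℕ → ℕ → ℕ
#monomials n d = length (monomials n d)

#monomials-suc : ∀ n d → #monomials (suc n) (suc d) ≡ #monomials (suc n) d + #monomials n (suc d)
#monomials-suc n d = trans (length-++ (map x₀· (monomials (suc n) d)))
  (cong₂ _+_ (length-map x₀· (monomials (suc n) d)) (length-map (0 ∷_) (monomials n (suc d))))

#monomials-1 : ∀ n → #monomials n 1 ≡ n
#monomials-1 zero    = refl
#monomials-1 (suc n) = trans (#monomials-suc n 0) (cong suc (#monomials-1 n))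

-- All monomials of degree 2 divide x₀-multiples, so the α generators not involving x₀ are free.
core : ∀ N α → α ≤ #monomials N 3 → Configuration (suc N) (#monomials (suc N) 2) (#monomials (suc N) 2 + α)
core N α α≤ = record
  { level₃ = generators-level
      (++⁺ (map⁺ x₀·-injective (monomials-unique (suc N) 2))
           (map⁺ 0∷-injective (take⁺ α (monomials-unique N 3))) x₀·-disjoint)
      deg-T
  ; level₂ = record
    { unique-level = monomials-unique (suc N) 2
    ; sound        = λ {m} m∈ → ∈-monomials⁻ (suc N) 2 m∈ , x₀· m , ∈-++⁺ˡ (∈-map⁺ x₀· m∈) , ∣-x₀· m
    ; complete     = λ {m} _ _ → ∈-monomials⁺ (suc N) 2 m
    }
  ; level₁ = record
    { unique-level = monomials-unique (suc N) 1
    ; sound        = λ {m} m∈ → ∈-monomials⁻ (suc N) 1 m∈ , x₀· (x₀· m) ,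
        ∈-++⁺ˡ (∈-map⁺ x₀· (∈-monomials⁺ (suc N) 2 (x₀· m) (trans (deg-x₀· m) (cong suc (∈-monomials⁻ (suc N) 1 m∈))))) ,
        ∣-trans (∣-x₀· m) (∣-x₀· (x₀· m))
    ; complete     = λ {m} _ _ → ∈-monomials⁺ (suc N) 1 m
    }
  ; size₃ = trans (length-++ (map x₀· (monomials (suc N) 2))) (cong₂ _+_ (length-map x₀· (monomials (suc N) 2))
      (trans (length-map (0 ∷_) (take α (monomials N 3))) (trans (length-take α (monomials N 3)) (m≤n⇒m⊓n≡m α≤))))
  ; size₂ = refl
  ; size₁ = #monomials-1 (suc N)
  }
  where
  deg-T : ∀ {m} → m ∈ map x₀· (monomials (suc N) 2) ++ map (0 ∷_) (take α (monomials N 3)) → deg m ≡ 3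
  deg-T m∈ with ∈-++⁻ (map x₀· (monomials (suc N) 2)) m∈
  ... | inj₁ p with w , w∈ , refl ← ∈-map⁻ x₀· p = trans (deg-x₀· w) (cong suc (∈-monomials⁻ (suc N) 2 w∈))
  ... | inj₂ p with w , w∈ , refl ← ∈-map⁻ (0 ∷_) p = ∈-monomials⁻ N 3 (∈-take⁻ α _ w∈)

-- Generators: the cubes of all variables and δ of the monomials uᵢ vⱼ wᵢ₊ⱼ.
-- Any two of i, j, i + j determine the third, so no two of these monomials share a degree 2 divisor.
latin : ∀ M δ → δ ≤ M * M → let n = M + (M + (M + M)) in Configuration n (n + (δ + (δ + δ))) (n + δ)
latin M δ δ≤ = record
  { level₃ = generators-level
      (++⁺ (map⁺ cube-injective (allFin⁺ n)) (map⁺ uvw-injective D-unique) cube#uvw) deg-T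
  ; level₂ = record
    { unique-level =
        ++⁺ (map⁺ sq-injective (allFin⁺ n))
            (++⁺ (map⁺ uv-injective D-unique) (++⁺ (map⁺ uw-injective D-unique) (map⁺ vw-injective D-unique) uw#vw)
              (disjoint-++ uv#uw uv#vw))
            (disjoint-++ (sq# uv λ p → u≢v) (disjoint-++ (sq# uw λ p → u≢w) (sq# vw λ p → v≢w)))
    ; sound = sound₂
    ; complete = complete₂
    }
  ; level₁ = record
    { unique-level = map⁺ var-injective (allFin⁺ n)
    ; sound = sound₁
    ; complete = λ {m} _ _ d → complete₁ (deg≡1⇒var m d)
    }
  ; size₃ = trans (length-++ (map cube (allFin n))) (cong₂ _+_ (len cube) (len-D uvw))
  ; size₂ = trans (length-++ (map sq (allFin n))) (cong₂ _+_ (len sq)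
      (trans (length-++ (map uv′ D)) (cong₂ _+_ (len-D uv′)
        (trans (length-++ (map uw′ D)) (cong₂ _+_ (len-D uw′) (len-D vw′))))))
  ; size₁ = len var
  }
  where
  n : ℕ
  n = M + (M + (M + M))

  u : Fin M → Fin n
  u i = i ↑ˡ (M + (M + M))

  v : Fin M → Fin n
  v j = M ↑ʳ (j ↑ˡ (M + M))

  -- The third block has 2M variables so that i + j serves as an index without reduction modulo M.
  w : Fin (M + M) → Fin n
  w k = M ↑ʳ (M ↑ʳ k)

  -- A left inverse of `u`, `v` and `w` at once: their injectivity and the disjointness of their
  -- images reduce to constructors of a sum.
  label : Fin n → Fin M ⊎ Fin M ⊎ Fin (M + M)
  label x = Sum.map₂ (splitAt M) (splitAt M x)

  label-u : ∀ i → label (u i) ≡ inj₁ i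
  label-u i = cong (Sum.map₂ (splitAt M)) (splitAt-↑ˡ M i _)

  label-v : ∀ j → label (v j) ≡ inj₂ (inj₁ j)
  label-v j = trans (cong (Sum.map₂ (splitAt M)) (splitAt-↑ʳ M _ (j ↑ˡ (M + M)))) (cong inj₂ (splitAt-↑ˡ M j _))

  label-w : ∀ k → label (w k) ≡ inj₂ (inj₂ k)
  label-w k = trans (cong (Sum.map₂ (splitAt M)) (splitAt-↑ʳ M _ (M ↑ʳ k))) (cong inj₂ (splitAt-↑ʳ M _ k))

  u-injective : ∀ {i i'} → u i ≡ u i' → i ≡ i'
  u-injective {i} {i'} p = inj₁-injective (trans (sym (label-u i)) (trans (cong label p) (label-u i')))

  v-injective : ∀ {j j'} → v j ≡ v j' → j ≡ j'
  v-injective {j} {j'} p = inj₁-injective (inj₂-injective (trans (sym (label-v j)) (trans (cong label p) (label-v j'))))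

  w-injective : ∀ {k k'} → w k ≡ w k' → k ≡ k'
  w-injective {k} {k'} p = inj₂-injective (inj₂-injective (trans (sym (label-w k)) (trans (cong label p) (label-w k'))))

  u≢v : ∀ {i j} → u i ≢ v j
  u≢v {i} {j} p with () ← trans (sym (label-u i)) (trans (cong label p) (label-v j))

  u≢w : ∀ {i k} → u i ≢ w k
  u≢w {i} {k} p with () ← trans (sym (label-u i)) (trans (cong label p) (label-w k))

  v≢w : ∀ {j k} → v j ≢ w k
  v≢w {j} {k} p with () ← trans (sym (label-v j)) (trans (cong label p) (label-w k))

  s : Fin M → Fin M → Fin (M + M)
  s i j = fromℕ< (+-mono-< (toℕ<n i) (toℕ<n j))

  toℕ-s : ∀ i j → toℕ (s i j) ≡ toℕ i + toℕ j
  toℕ-s i j = toℕ-fromℕ< (+-mono-< (toℕ<n i) (toℕ<n j))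

  s-cancelˡ : ∀ {i j j'} → s i j ≡ s i j' → j ≡ j'
  s-cancelˡ {i} {j} {j'} p = toℕ-injective (+-cancelˡ-≡ (toℕ i) _ _ (trans (sym (toℕ-s i j)) (trans (cong toℕ p) (toℕ-s i j'))))

  s-cancelʳ : ∀ {i i' j} → s i j ≡ s i' j → i ≡ i'
  s-cancelʳ {i} {i'} {j} p = toℕ-injective (+-cancelʳ-≡ (toℕ j) _ _ (trans (sym (toℕ-s i j)) (trans (cong toℕ p) (toℕ-s i' j))))

  D : List (Fin M × Fin M)
  D = take δ (cartesianProduct (allFin M) (allFin M))

  D-unique : Unique D
  D-unique = take⁺ δ (cartesianProduct⁺ (allFin⁺ M) (allFin⁺ M))

  length-D : length D ≡ δ
  length-D = trans (length-take δ (cartesianProduct (allFin M) (allFin M))) (m≤n⇒m⊓n≡m (subst (δ ≤_) (sym size) δ≤))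
    where
    size : length (cartesianProduct (allFin M) (allFin M)) ≡ M * M
    size = trans (length-cartesianProduct (allFin M) (allFin M)) (cong₂ _*_ (length-tabulate {n = M} (λ i → i)) (length-tabulate {n = M} (λ i → i)))

  -- The cubes bring in every variable and its square beforehand, so a mixed generator adds no
  -- variable and just its three quadratic divisors: (0, 3).
  sq cube : Fin n → Monomial n
  sq x = var² x x
  cube x = var³ x x x

  uv uw vw : Fin M × Fin M → Fin n × Fin n
  uv (i , j) = u i , v j
  uw (i , j) = u i , w (s i j)
  vw (i , j) = v j , w (s i j)

  pair : Fin n × Fin n → Monomial n
  pair (x , y) = var² x y

  uv′ uw′ vw′ uvw : Fin M × Fin M → Monomial n
  uv′ d = pair (uv d)
  uw′ d = pair (uw d)
  vw′ d = pair (vw d)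
  uvw (i , j) = var³ (u i) (v j) (w (s i j))

  len : (f : Fin n → Monomial n) → length (map f (allFin n)) ≡ n
  len f = trans (length-map f (allFin n)) (length-tabulate {n = n} (λ i → i))

  len-D : (f : Fin M × Fin M → Monomial n) → length (map f D) ≡ δ
  len-D f = trans (length-map f D) length-D

  left : ∀ {x y m} → pair (x , y) ≡ m → var x ∣ₘ m
  left {x} {y} p = subst (var x ∣ₘ_) p (∣-⊕ʳ (var x) (var y))

  right : ∀ {x y m} → pair (x , y) ≡ m → var y ∣ₘ m
  right {x} {y} p = subst (var y ∣ₘ_) p (∣-⊕ˡ (var y) (var x))

  sq-injective : ∀ {x x'} → sq x ≡ sq x' → x ≡ x'
  sq-injective {x} {x'} p = var∣square x x' (left p)

  cube-injective : ∀ {x x'} → cube x ≡ cube x' → x ≡ x'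
  cube-injective {x} {x'} p = var∣cube x x' (subst (var x ∣ₘ_) p (i∣ x x x))

  u∣uv : ∀ {i i' j'} → var (u i) ∣ₘ var² (u i') (v j') → i ≡ i'
  u∣uv {i} {i'} {j'} p with var∣var² (u i) (u i') (v j') p
  ... | inj₁ q = u-injective q
  ... | inj₂ q = ⊥-elim (u≢v q)

  v∣uv : ∀ {j i' j'} → var (v j) ∣ₘ var² (u i') (v j') → j ≡ j'
  v∣uv {j} {i'} {j'} p with var∣var² (v j) (u i') (v j') p
  ... | inj₁ q = ⊥-elim (u≢v (sym q))
  ... | inj₂ q = v-injective q

  u∣uw : ∀ {i i' k'} → var (u i) ∣ₘ var² (u i') (w k') → i ≡ i'
  u∣uw {i} {i'} {k'} p with var∣var² (u i) (u i') (w k') p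
  ... | inj₁ q = u-injective q
  ... | inj₂ q = ⊥-elim (u≢w q)

  w∣uw : ∀ {k i' k'} → var (w k) ∣ₘ var² (u i') (w k') → k ≡ k'
  w∣uw {k} {i'} {k'} p with var∣var² (w k) (u i') (w k') p
  ... | inj₁ q = ⊥-elim (u≢w (sym q))
  ... | inj₂ q = w-injective q

  v∣vw : ∀ {j j' k'} → var (v j) ∣ₘ var² (v j') (w k') → j ≡ j'
  v∣vw {j} {j'} {k'} p with var∣var² (v j) (v j') (w k') p
  ... | inj₁ q = v-injective q
  ... | inj₂ q = ⊥-elim (v≢w q)

  w∣vw : ∀ {k j' k'} → var (w k) ∣ₘ var² (v j') (w k') → k ≡ k'
  w∣vw {k} {j'} {k'} p with var∣var² (w k) (v j') (w k') p
  ... | inj₁ q = ⊥-elim (v≢w (sym q))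
  ... | inj₂ q = w-injective q

  uv-injective : ∀ {d d'} → uv′ d ≡ uv′ d' → d ≡ d'
  uv-injective p = cong₂ _,_ (u∣uv (left p)) (v∣uv (right p))

  uw-injective : ∀ {d d'} → uw′ d ≡ uw′ d' → d ≡ d'
  uw-injective p with refl ← u∣uw (left p) = cong (_ ,_) (s-cancelˡ (w∣uw (right p)))

  vw-injective : ∀ {d d'} → vw′ d ≡ vw′ d' → d ≡ d'
  vw-injective p with refl ← v∣vw (left p) = cong (_, _) (s-cancelʳ (w∣vw (right p)))

  uvw-injective : ∀ {d d'} → uvw d ≡ uvw d' → d ≡ d'
  uvw-injective {i , j} {i' , j'} p = cong₂ _,_ i≡i' j≡j'
    where
    i≡i' : i ≡ i'
    i≡i' with var∣var³ (u i) (u i') (v j') (w (s i' j')) (subst (var (u i) ∣ₘ_) p (i∣ _ _ _))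
    ... | inj₁ q        = u-injective q
    ... | inj₂ (inj₁ q) = ⊥-elim (u≢v q)
    ... | inj₂ (inj₂ q) = ⊥-elim (u≢w q)
    j≡j' : j ≡ j'
    j≡j' with var∣var³ (v j) (u i') (v j') (w (s i' j')) (subst (var (v j) ∣ₘ_) p (j∣ (u i) _ _))
    ... | inj₁ q        = ⊥-elim (u≢v (sym q))
    ... | inj₂ (inj₁ q) = v-injective q
    ... | inj₂ (inj₂ q) = ⊥-elim (v≢w q)

  cube#uvw : Disjoint (map cube (allFin n)) (map uvw D)
  cube#uvw = disjoint-map λ {x} {d} p → u≢v (trans
    (var∣cube (u (proj₁ d)) x (subst (_ ∣ₘ_) (sym p) (i∣ _ _ _)))
    (sym (var∣cube (v (proj₂ d)) x (subst (_ ∣ₘ_) (sym p) (j∣ (u (proj₁ d)) _ _)))))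

  -- A square has only one variable divisor, a mixed product has two.
  sq# : (f : Fin M × Fin M → Fin n × Fin n) → (∀ d → proj₁ (f d) ≢ proj₂ (f d)) →
        Disjoint (map sq (allFin n)) (map (λ d → pair (f d)) D)
  sq# f ≢f = disjoint-map λ {x} {d} p → ≢f d (trans
    (var∣square (proj₁ (f d)) x (left (sym p))) (sym (var∣square (proj₂ (f d)) x (right (sym p)))))

  uv#uw : Disjoint (map uv′ D) (map uw′ D)
  uv#uw = disjoint-map λ {d} {d'} p → Sum.[ (λ q → u≢v (sym q)) , v≢w ]
    (var∣var² (v (proj₂ d)) (u (proj₁ d')) _ (right p))

  uv#vw : Disjoint (map uv′ D) (map vw′ D)
  uv#vw = disjoint-map λ {d} {d'} p → Sum.[ u≢v , u≢w ] (var∣var² (u (proj₁ d)) (v (proj₂ d')) _ (left p))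

  uw#vw : Disjoint (map uw′ D) (map vw′ D)
  uw#vw = disjoint-map λ {d} {d'} p → Sum.[ u≢v , u≢w ] (var∣var² (u (proj₁ d)) (v (proj₂ d')) _ (left p))

  T Q : List (Monomial n)
  T = map cube (allFin n) ++ map uvw D
  Q = map sq (allFin n) ++ map uv′ D ++ map uw′ D ++ map vw′ D

  T⁻ : ∀ {m} → m ∈ T → (∃ λ x → m ≡ cube x) ⊎ (∃ λ d → d ∈ D × m ≡ uvw d)
  T⁻ m∈ with ∈-++⁻ (map cube (allFin n)) m∈
  ... | inj₁ p = let x , _ , eq = ∈-map⁻ cube p in inj₁ (x , eq)
  ... | inj₂ p = inj₂ (∈-map⁻ uvw p)

  cube∈T : ∀ x → cube x ∈ T
  cube∈T x = ∈-++⁺ˡ (∈-map⁺ cube (∈-allFin x))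

  uvw∈T : ∀ {d} → d ∈ D → uvw d ∈ T
  uvw∈T d∈ = ∈-++⁺ʳ (map cube (allFin n)) (∈-map⁺ uvw d∈)

  deg-T : ∀ {m} → m ∈ T → deg m ≡ 3
  deg-T m∈ with T⁻ m∈
  ... | inj₁ (x , refl)           = deg-var³ x x x
  ... | inj₂ ((i , j) , _ , refl) = deg-var³ (u i) (v j) (w (s i j))

  sound₁ : ∀ {m} → m ∈ map var (allFin n) → deg m ≡ 1 × ∃ λ τ → τ ∈ T × m ∣ₘ τ
  sound₁ m∈ with x , _ , refl ← ∈-map⁻ var m∈ = deg-var x , cube x , cube∈T x , i∣ x x x

  complete₁ : ∀ {m} → (∃ λ x → m ≡ var x) → m ∈ map var (allFin n)
  complete₁ (x , refl) = ∈-map⁺ var (∈-allFin x)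

  sound₂ : ∀ {m} → m ∈ Q → deg m ≡ 2 × ∃ λ τ → τ ∈ T × m ∣ₘ τ
  sound₂ m∈ with ∈-++⁻ (map sq (allFin n)) m∈
  ... | inj₁ p with x , _ , refl ← ∈-map⁻ sq p = deg-var² x x , cube x , cube∈T x , jk∣ x x x
  ... | inj₂ m∈′ with ∈-++⁻ (map uv′ D) m∈′
  ...   | inj₁ p with d@(i , j) , d∈ , refl ← ∈-map⁻ uv′ p = deg-var² (u i) (v j) , uvw d , uvw∈T d∈ , ij∣ (u i) (v j) (w (s i j))
  ...   | inj₂ m∈″ with ∈-++⁻ (map uw′ D) m∈″
  ...     | inj₁ p with d@(i , j) , d∈ , refl ← ∈-map⁻ uw′ p = deg-var² (u i) (w (s i j)) , uvw d , uvw∈T d∈ , ik∣ (u i) (v j) (w (s i j))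
  ...     | inj₂ p with d@(i , j) , d∈ , refl ← ∈-map⁻ vw′ p = deg-var² (v j) (w (s i j)) , uvw d , uvw∈T d∈ , jk∣ (u i) (v j) (w (s i j))

  complete₂ : ∀ {m τ} → τ ∈ T → m ∣ₘ τ → deg m ≡ 2 → m ∈ Q
  complete₂ {m} τ∈ m∣ dm with T⁻ τ∈
  ... | inj₁ (x , refl) = ∈-++⁺ˡ (subst (_∈ map sq (allFin n))
          (sym (Sum.[ id , Sum.[ id , id ] ] (var³-deg2-divisor m x x x m∣ dm))) (∈-map⁺ sq (∈-allFin x)))
  ... | inj₂ ((i , j) , d∈ , refl) with var³-deg2-divisor m (u i) (v j) (w (s i j)) m∣ dm
  ...   | inj₁ refl        = ∈-++⁺ʳ (map sq (allFin n)) (∈-++⁺ʳ (map uv′ D) (∈-++⁺ʳ (map uw′ D) (∈-map⁺ vw′ d∈)))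
  ...   | inj₂ (inj₁ refl) = ∈-++⁺ʳ (map sq (allFin n)) (∈-++⁺ʳ (map uv′ D) (∈-++⁺ˡ (∈-map⁺ uw′ d∈)))
  ...   | inj₂ (inj₂ refl) = ∈-++⁺ʳ (map sq (allFin n)) (∈-++⁺ˡ (∈-map⁺ uv′ d∈))

-- Counting

#monomials-2 : ∀ n → 2 * #monomials n 2 ≡ n * suc n
#monomials-2 zero    = refl
#monomials-2 (suc n) = begin
  2 * #monomials (suc n) 2       ≡⟨ cong (2 *_) (trans (#monomials-suc n 1) (cong (_+ #monomials n 2) (#monomials-1 (suc n)))) ⟩
  2 * (suc n + #monomials n 2)   ≡⟨ *-distribˡ-+ 2 (suc n) (#monomials n 2) ⟩
  2 * suc n + 2 * #monomials n 2 ≡⟨ cong (2 * suc n +_) (#monomials-2 n) ⟩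
  2 * suc n + n * suc n          ≡⟨ collect n ⟩
  suc n * suc (suc n)            ∎
  where
  open ≡-Reasoning
  collect : ∀ n → 2 * suc n + n * suc n ≡ suc n * suc (suc n)
  collect = solve-∀

#monomials-3 : ∀ n → 6 * #monomials n 3 ≡ n * suc n * suc (suc n)
#monomials-3 zero    = refl
#monomials-3 (suc n) = begin
  6 * #monomials (suc n) 3                              ≡⟨ cong (6 *_) (#monomials-suc n 2) ⟩
  6 * (#monomials (suc n) 2 + #monomials n 3)           ≡⟨ regroup (#monomials (suc n) 2) (#monomials n 3) ⟩
  3 * (2 * #monomials (suc n) 2) + 6 * #monomials n 3   ≡⟨ cong₂ (λ p q → 3 * p + q) (#monomials-2 (suc n)) (#monomials-3 n) ⟩
  3 * (suc n * suc (suc n)) + n * suc n * suc (suc n)   ≡⟨ collect n ⟩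
  suc n * suc (suc n) * suc (suc (suc n))               ∎
  where
  open ≡-Reasoning
  collect : ∀ n → 3 * (suc n * suc (suc n)) + n * suc n * suc (suc n) ≡ suc n * suc (suc n) * suc (suc (suc n))
  collect = solve-∀
  regroup : ∀ p q → 6 * (p + q) ≡ 3 * (2 * p) + 6 * q
  regroup = solve-∀

divide-by-3 : ∀ y → ∃₂ λ q e → y ≡ e + q * 3 × e ≤ 2
divide-by-3 y = y ℕ./ 3 , y ℕ.% 3 , m≡m%n+[m/n]*n y 3 , s≤s⁻¹ (m%n<n y 3)

cast : ∀ {r a t r' a' t'} → r ≡ r' → a ≡ a' → t ≡ t' → Configuration r a t → Configuration r' a' t'
cast refl refl refl C = C

-- core 1 0 has type (2, 3, 3) and core 0 0 type (1, 1, 1), so a − r grows by 3δ + e and r by 2e + β + 3γ.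
assemble : ∀ N M α δ e β γ → α ≤ #monomials N 3 → δ ≤ M * M →
           let A = #monomials (suc N) 2 ; n = M + (M + (M + M)) in
           Configuration (suc N + (n + (e * 2 + (β * 1 + γ * 3))))
                         (A + ((n + (δ + (δ + δ))) + (e * 3 + (β * 1 + γ * 3))))
                         ((A + α) + ((n + δ) + (e * 3 + (β * 1 + γ * 1))))
assemble N M α δ e β γ α≤ δ≤ =
  core N α α≤ ⊞ latin M δ δ≤ ⊞ copies e (core 1 0 z≤n) ⊞ copies β (core 0 0 z≤n) ⊞ copies γ squarefree-triple

-- Choosing the multiplicities for a prescribed pair

module _ (N M : ℕ) where

  private
    A n : ℕ
    A = #monomials (suc N) 2
    n = M + (M + (M + M))

  -- The 4 is the largest value of 2e, the contribution to r of the e ≤ 2 copies that adjust y: then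
  -- `β + γ * 3` has to equal x + 4 - 2e, which is never negative. The 20 bounds 2(e + f) + 6e + 2β
  -- with e + f = 2, e ≤ 2 and β ≤ 2.
  offset₁ offset₂ slack : ℕ
  offset₁ = suc N + n + 4
  offset₂ = A + n + 4
  slack   = 3 * A + 3 * n + 20

  private
    solve-parameters : ∀ {t} x y → x + y + slack ≤ 3 * t → t ≤ #monomials N 3 → t ≤ M * M →
           ∀ δ e γ β → y ≡ e + δ * 3 → e ≤ 2 → x + 2 * (2 ∸ e) ≡ β + γ * 3 → β ≤ 2 →
           Configuration (offset₁ + x) (offset₂ + (x + y)) t
    solve-parameters {t} x y bound t≤₁ t≤₂ δ e γ β refl e≤2 x-eq β≤2 =
      cast r-eq a-eq t-eq (assemble N M α δ e β γ (≤-trans α≤t t≤₁) (≤-trans δ≤t t≤₂))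
      where
      open ≡-Reasoning

      f : ℕ
      f = 2 ∸ e

      e+f : e + f ≡ 2
      e+f = m+[n∸m]≡n e≤2

      -- All generators except the free ones of the core; `α` is the remainder up to t. The count is
      -- compared with t after tripling, because δ and γ are thirds of y and x up to residues.
      used : ℕ
      used = A + n + δ + e * 3 + β + γ

      x-eq′ : 3 * (A + n + δ + e * 3 + β + γ) ≡ 3 * A + 3 * n + (e + δ * 3) + e * 8 + 2 * β + (x + 2 * f)
      x-eq′ = trans (lhs A n δ e β γ) (cong (3 * A + 3 * n + (e + δ * 3) + e * 8 + 2 * β +_) (sym x-eq))
        where
        lhs : ∀ A n δ e β γ → 3 * (A + n + δ + e * 3 + β + γ) ≡ 3 * A + 3 * n + (e + δ * 3) + e * 8 + 2 * β + (β + γ * 3)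
        lhs = solve-∀

      used≤t : used ≤ t
      used≤t = *-cancelˡ-≤ 3 (≤-trans (≤-reflexive x-eq′) (≤-trans est bound))
        where
        shape : ∀ A n y e β x f → 3 * A + 3 * n + y + e * 8 + 2 * β + (x + 2 * f) ≡ x + y + (3 * A + 3 * n + (2 * (e + f) + 6 * e + 2 * β))
        shape = solve-∀
        est : 3 * A + 3 * n + (e + δ * 3) + e * 8 + 2 * β + (x + 2 * f) ≤ x + (e + δ * 3) + slack
        est = ≤-trans (≤-reflexive (shape A n (e + δ * 3) e β x f))
          (+-monoʳ-≤ (x + (e + δ * 3)) (+-monoʳ-≤ (3 * A + 3 * n)
            (+-mono-≤ (+-mono-≤ (≤-reflexive (cong (2 *_) e+f)) (*-monoʳ-≤ 6 e≤2)) (*-monoʳ-≤ 2 β≤2))))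

      α : ℕ
      α = t ∸ used

      α≤t : α ≤ t
      α≤t = m∸n≤m t used

      δ≤t : δ ≤ t
      δ≤t = ≤-trans (≤-trans (m≤n+m δ (A + n + e * 3 + β + γ)) (≤-reflexive (perm A n δ e β γ))) used≤t
        where
        perm : ∀ A n δ e β γ → A + n + e * 3 + β + γ + δ ≡ A + n + δ + e * 3 + β + γ
        perm = solve-∀

      r-eq : suc N + (n + (e * 2 + (β * 1 + γ * 3))) ≡ offset₁ + x
      r-eq = begin
        suc N + (n + (e * 2 + (β * 1 + γ * 3))) ≡⟨ shape₁ N n e β γ ⟩
        suc N + n + 2 * e + (β + γ * 3)         ≡⟨ cong (suc N + n + 2 * e +_) (sym x-eq) ⟩
        suc N + n + 2 * e + (x + 2 * f)         ≡⟨ shape₂ N n e x f ⟩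
        suc N + n + 2 * (e + f) + x             ≡⟨ cong (λ z → suc N + n + 2 * z + x) e+f ⟩
        offset₁ + x                             ∎
        where
        shape₁ : ∀ N n e β γ → suc N + (n + (e * 2 + (β * 1 + γ * 3))) ≡ suc N + n + 2 * e + (β + γ * 3)
        shape₁ = solve-∀
        shape₂ : ∀ N n e x f → suc N + n + 2 * e + (x + 2 * f) ≡ suc N + n + 2 * (e + f) + x
        shape₂ = solve-∀

      a-eq : A + ((n + (δ + (δ + δ))) + (e * 3 + (β * 1 + γ * 3))) ≡ offset₂ + (x + (e + δ * 3))
      a-eq = begin
        A + ((n + (δ + (δ + δ))) + (e * 3 + (β * 1 + γ * 3))) ≡⟨ shape₁ A n δ e β γ ⟩
        A + n + δ * 3 + e * 3 + (β + γ * 3)                   ≡⟨ cong (A + n + δ * 3 + e * 3 +_) (sym x-eq) ⟩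
        A + n + δ * 3 + e * 3 + (x + 2 * f)                   ≡⟨ shape₂ A n δ e x f ⟩
        A + n + 2 * (e + f) + (x + (e + δ * 3))               ≡⟨ cong (λ z → A + n + 2 * z + (x + (e + δ * 3))) e+f ⟩
        offset₂ + (x + (e + δ * 3))                           ∎
        where
        shape₁ : ∀ A n δ e β γ → A + ((n + (δ + (δ + δ))) + (e * 3 + (β * 1 + γ * 3))) ≡ A + n + δ * 3 + e * 3 + (β + γ * 3)
        shape₁ = solve-∀
        shape₂ : ∀ A n δ e x f → A + n + δ * 3 + e * 3 + (x + 2 * f) ≡ A + n + 2 * (e + f) + (x + (e + δ * 3))
        shape₂ = solve-∀

      t-eq : (A + α) + ((n + δ) + (e * 3 + (β * 1 + γ * 1))) ≡ t
      t-eq = trans (shape A α n δ e β γ) (m+[n∸m]≡n used≤t)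
        where
        shape : ∀ A α n δ e β γ → (A + α) + ((n + δ) + (e * 3 + (β * 1 + γ * 1))) ≡ A + n + δ + e * 3 + β + γ + α
        shape = solve-∀

  configuration : ∀ {t} x y → x + y + slack ≤ 3 * t → t ≤ #monomials N 3 → t ≤ M * M →
                  Configuration (offset₁ + x) (offset₂ + (x + y)) t
  configuration x y bound t≤₁ t≤₂ =
    let δ , e , y-eq , e≤2 = divide-by-3 y
        γ , β , x-eq , β≤2 = divide-by-3 (x + 2 * (2 ∸ e))
    in solve-parameters x y bound t≤₁ t≤₂ δ e γ β y-eq e≤2 x-eq β≤2

-- Counting the pairs from both sides

triangle : ℕ → List (ℕ × ℕ)
triangle zero    = []
triangle (suc k) = map (_, k) (upTo (suc k)) ++ triangle k

∈-triangle⁻ : ∀ k {x z} → (x , z) ∈ triangle k → x ≤ z × z < k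
∈-triangle⁻ (suc k) p with ∈-++⁻ (map (_, k) (upTo (suc k))) p
... | inj₂ q = let x≤z , z<k = ∈-triangle⁻ k q in x≤z , m≤n⇒m≤1+n z<k
... | inj₁ q with x , x∈ , refl ← ∈-map⁻ (_, k) q = s≤s⁻¹ (∈-upTo⁻ x∈) , ≤-refl

∈-triangle⁺ : ∀ k {x z} → x ≤ z → z < k → (x , z) ∈ triangle k
∈-triangle⁺ (suc k) {x} {z} x≤z (s≤s z≤k) with m≤n⇒m<n∨m≡n z≤k
... | inj₁ z<k  = ∈-++⁺ʳ (map (_, k) (upTo (suc k))) (∈-triangle⁺ k x≤z z<k)
... | inj₂ refl = ∈-++⁺ˡ (∈-map⁺ (_, k) (∈-upTo⁺ (s≤s x≤z)))

triangle-unique : ∀ k → Unique (triangle k)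
triangle-unique zero    = []
triangle-unique (suc k) = ++⁺ (map⁺ (cong proj₁) (upTo⁺ (suc k))) (triangle-unique k) disjoint
  where
  disjoint : ∀ {p} → ¬ (p ∈ map (_, k) (upTo (suc k)) × p ∈ triangle k)
  disjoint (p , q) with x , _ , refl ← ∈-map⁻ (_, k) p = <-irrefl refl (proj₂ (∈-triangle⁻ k q))

2*length-triangle : ∀ k → 2 * length (triangle k) ≡ k * suc k
2*length-triangle zero    = refl
2*length-triangle (suc k) = begin
  2 * length (map (_, k) (upTo (suc k)) ++ triangle k) ≡⟨ cong (2 *_) (length-++ (map (_, k) (upTo (suc k)))) ⟩
  2 * (length (map (_, k) (upTo (suc k))) + length (triangle k))
    ≡⟨ cong (λ z → 2 * (z + length (triangle k))) (trans (length-map (_, k) (upTo (suc k))) (length-upTo (suc k))) ⟩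
  2 * (suc k + length (triangle k))    ≡⟨ *-distribˡ-+ 2 (suc k) (length (triangle k)) ⟩
  2 * suc k + 2 * length (triangle k)  ≡⟨ cong (2 * suc k +_) (2*length-triangle k) ⟩
  2 * suc k + k * suc k                ≡⟨ collect k ⟩
  suc k * suc (suc k)                  ∎
  where
  open ≡-Reasoning
  collect : ∀ k → 2 * suc k + k * suc k ≡ suc k * suc (suc k)
  collect = solve-∀

module _ {P : ℕ → ℕ} (counts : Counts P) where

  count-upper : ∀ t → 2 * P t ≤ suc (3 * t) * suc (suc (3 * t))
  count-upper t with L , uL , refl-len , L⇔ ← counts t = begin
    2 * P t                             ≡⟨ cong (2 *_) (sym refl-len) ⟩
    2 * length L                        ≤⟨ *-monoʳ-≤ 2 (Unique-⊆-length uL λ {p} → sub {p}) ⟩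
    2 * length (triangle (suc (3 * t))) ≡⟨ 2*length-triangle (suc (3 * t)) ⟩
    suc (3 * t) * suc (suc (3 * t))     ∎
    where
    open ≤-Reasoning
    sub : ∀ {p} → p ∈ L → p ∈ triangle (suc (3 * t))
    sub {r , a} p∈ = let r≤a , a≤3t = OSeq3-bounds (Equivalence.to (L⇔ r a) p∈) in ∈-triangle⁺ _ r≤a (s≤s a≤3t)

  count-lower : ∀ N M t → suc t ≤ #monomials N 3 → suc t ≤ M * M →
                let k = 3 * suc t ∸ slack N M in k * suc k ≤ 2 * P (suc t)
  count-lower N M t t≤₁ t≤₂ with L , uL , refl-len , L⇔ ← counts (suc t) = begin
    k * suc k                          ≡⟨ sym (2*length-triangle k) ⟩
    2 * length (triangle k)            ≡⟨ cong (2 *_) (sym (length-map shift (triangle k))) ⟩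
    2 * length (map shift (triangle k)) ≤⟨ *-monoʳ-≤ 2 (Unique-⊆-length (map⁺ shift-injective (triangle-unique k)) sub) ⟩
    2 * length L                       ≡⟨ cong (2 *_) refl-len ⟩
    2 * P (suc t)                      ∎
    where
    open ≤-Reasoning
    k : ℕ
    k = 3 * suc t ∸ slack N M
    shift : ℕ × ℕ → ℕ × ℕ
    shift (x , z) = offset₁ N M + x , offset₂ N M + z
    shift-injective : ∀ {p q} → shift p ≡ shift q → p ≡ q
    shift-injective eq = cong₂ _,_ (+-cancelˡ-≡ (offset₁ N M) _ _ (cong proj₁ eq)) (+-cancelˡ-≡ (offset₂ N M) _ _ (cong proj₂ eq))
    sub : ∀ {p} → p ∈ map shift (triangle k) → p ∈ L
    sub p∈ with (x , z) , xz∈ , refl ← ∈-map⁻ shift p∈ with x≤z , z<k ← ∈-triangle⁻ k xz∈ =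
      Equivalence.from (L⇔ _ _) (realise (cast refl (cong (offset₂ N M +_) (m+[n∸m]≡n x≤z)) refl
        (configuration N M x (z ∸ x) bound t≤₁ t≤₂)))
      where
      bound : x + (z ∸ x) + slack N M ≤ 3 * suc t
      bound rewrite m+[n∸m]≡n x≤z = <⇒≤ (m<n∸o⇒m+o<n′ z<k)
        where
        -- A truncated difference that exceeds some m is positive, hence a genuine difference.
        m<n∸o⇒m+o<n′ : ∀ {m n o} → m < n ∸ o → m + o < n
        m<n∸o⇒m+o<n′ {m} {n} {o} p = ≤-trans (+-monoˡ-≤ o p) (≤-reflexive (m∸n+n≡m (<⇒≤ (m∸n≢0⇒n<m {n} {o} λ q → n≮0 (subst (m <_) q p)))))

-- The limit

open import Data.Integer as ℤ using (+_; _⊖_; +<+; +[1+_])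
import Data.Integer.Properties as ℤ
open import Data.Rational as ℚ using (ℚ; mkℚ; toℚᵘ; _/_)
import Data.Rational.Properties as ℚ
open import Data.Rational.Unnormalised as ℚᵘ using (mkℚᵘ; *<*)
import Data.Rational.Unnormalised.Properties as ℚᵘ

cube-root : ∀ t → ∃ λ j → j * j * j ≤ t × t < suc j * suc j * suc j
cube-root zero = 0 , z≤n , s≤s z≤n
cube-root (suc t) with cube-root t
... | j , lo , hi with suc t <? suc j * suc j * suc j
...   | yes p = j , m≤n⇒m≤1+n lo , p
...   | no ¬p = suc j , ≮⇒≥ ¬p , ≤-<-trans hi (*-mono-< (*-mono-< (n<1+n (suc j)) (n<1+n (suc j))) (n<1+n (suc j)))

module _ (j : ℕ) where

  private
    -- Here m³ will exceed t. N = 2m gives about (2m)³/6 ≥ m³ cubic monomials, whereas N = m would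
    -- give only about m³/6. M = m² gives M² = m⁴ ≥ m³, and its cost 3n = 12m² in the slack is of
    -- the same order as 3A.
    m N M : ℕ
    m = suc j
    N = 2 * m
    M = m * m

  core-large : m * m * m ≤ #monomials N 3
  core-large = *-cancelˡ-≤ 6 (≤-trans (≤-trans (m≤m+n _ _) (≤-reflexive (expand m))) (≤-reflexive (sym (#monomials-3 N))))
    where
    expand : ∀ m → 6 * (m * m * m) + (2 * (m * m * m) + 12 * (m * m) + 4 * m) ≡ 2 * m * suc (2 * m) * suc (suc (2 * m))
    expand = solve-∀

  latin-large : m * m * m ≤ M * M
  latin-large = ≤-trans (≤-reflexive (*-assoc m m m)) (*-monoˡ-≤ (m * m) (m≤m*n m m))

  slack-value : slack N M ≡ 18 * (j * j) + 45 * j + 50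
  slack-value = trans (cong (λ A → 3 * A + 3 * (M + (M + (M + M))) + 20) A-value) (expand j)
    where
    A-value : #monomials (suc N) 2 ≡ suc (2 * m) * suc m
    A-value = *-cancelˡ-≡ _ _ 2 (trans (#monomials-2 (suc N)) (halve m))
      where
      halve : ∀ m → suc (2 * m) * suc (suc (2 * m)) ≡ 2 * (suc (2 * m) * suc m)
      halve = solve-∀
    expand : ∀ j → 3 * (suc (2 * suc j) * suc (suc j)) + 3 * (suc j * suc j + (suc j * suc j + (suc j * suc j + suc j * suc j))) + 20
                   ≡ 18 * (j * j) + 45 * j + 50
    expand = solve-∀

  -- One constant for both directions: 6 times the slack comes from the lower bound on the count, 11
  -- from 9t + 2 ≤ 11t in the upper bound. Replacing j and 1 by j² gives 689 = 108 + 270 + 311.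
  slack-bound : 1 ≤ j → 6 * slack N M + 11 ≤ 689 * (j * j)
  slack-bound 1≤j = begin
    6 * slack N M + 11                           ≡⟨ cong (λ s → 6 * s + 11) slack-value ⟩
    6 * (18 * (j * j) + 45 * j + 50) + 11        ≡⟨ expand j ⟩
    108 * (j * j) + (270 * j + 311 * 1)          ≤⟨ +-monoʳ-≤ (108 * (j * j)) (+-mono-≤ (*-monoʳ-≤ 270 j≤j²) (*-monoʳ-≤ 311 (≤-trans 1≤j j≤j²))) ⟩
    108 * (j * j) + (270 * (j * j) + 311 * (j * j)) ≡⟨ collect (j * j) ⟩
    689 * (j * j)                                ∎
    where
    open ≤-Reasoning
    j≤j² : j ≤ j * j
    j≤j² = subst (_≤ j * j) (*-identityˡ j) (*-monoˡ-≤ j 1≤j)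
    expand : ∀ j → 6 * (18 * (j * j) + 45 * j + 50) + 11 ≡ 108 * (j * j) + (270 * j + 311 * 1)
    expand = solve-∀
    collect : ∀ q → 108 * q + (270 * q + 311 * q) ≡ 689 * q
    collect = solve-∀

-- With k + s = 3t, (k + s)² ≤ k(k + 1) + 2s(k + s). If s exceeds 3t, the error term t · 6s is
-- already at least 9t², so t need not be large compared with s.
square-defect : ∀ {p} t s → (3 * t ∸ s) * suc (3 * t ∸ s) ≤ p → 9 * (t * t) ≤ p + t * (6 * s)
square-defect {p} t s k≤p with ≤-total s (3 * t)
... | inj₂ 3t≤s = begin
  9 * (t * t)         ≡⟨ nine t ⟩
  t * (3 * (3 * t))   ≤⟨ *-monoʳ-≤ t (*-mono-≤ {3} {6} (s≤s (s≤s (s≤s z≤n))) 3t≤s) ⟩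
  t * (6 * s)         ≤⟨ m≤n+m _ p ⟩
  p + t * (6 * s)     ∎
  where
  open ≤-Reasoning
  nine : ∀ t → 9 * (t * t) ≡ t * (3 * (3 * t))
  nine = solve-∀
... | inj₁ s≤3t = begin
  9 * (t * t)                              ≡⟨ nine t ⟩
  (3 * t) * (3 * t)                        ≡⟨ cong (λ z → z * z) (sym eq) ⟩
  (k + s) * (k + s)                        ≤⟨ m≤m+n _ (k + s * s) ⟩
  (k + s) * (k + s) + (k + s * s)          ≡⟨ regroup k s ⟩
  k * suc k + (k + s) * (2 * s)            ≡⟨ cong (λ z → k * suc k + z * (2 * s)) eq ⟩
  k * suc k + (3 * t) * (2 * s)            ≤⟨ +-monoˡ-≤ _ k≤p ⟩
  p + (3 * t) * (2 * s)                    ≡⟨ cong (λ z → p + z) (six t s) ⟩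
  p + t * (6 * s)                          ∎
  where
  open ≤-Reasoning
  k : ℕ
  k = 3 * t ∸ s
  regroup : ∀ k s → (k + s) * (k + s) + (k + s * s) ≡ k * suc k + (k + s) * (2 * s)
  regroup = solve-∀
  nine : ∀ t → 9 * (t * t) ≡ (3 * t) * (3 * t)
  nine = solve-∀
  six : ∀ t s → (3 * t) * (2 * s) ≡ t * (6 * s)
  six = solve-∀
  eq : k + s ≡ 3 * t
  eq = m∸n+n≡m s≤3t

∣⊖∣-bound : ∀ a b {c} → a ≤ b + c → b ≤ a + c → ℤ.∣ a ⊖ b ∣ ≤ c
∣⊖∣-bound a b {c} a≤ b≤ with ≤-total a b
... | inj₁ a≤b = subst (_≤ c) (sym (ℤ.∣⊖∣-≤ a≤b)) (m≤n+o⇒m∸n≤o b a b≤)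
... | inj₂ b≤a = subst (_≤ c) (sym (trans (ℤ.∣m⊖n∣≡∣n⊖m∣ a b) (ℤ.∣⊖∣-≤ b≤a))) (m≤n+o⇒m∸n≤o a b a≤)

ratio-close : ∀ p k {c} (ε : ℚ) → ℚ.0ℚ ℚ.< ε →
              2 * p ≤ 9 * (suc k * suc k) + c → 9 * (suc k * suc k) ≤ 2 * p + c →
              c * ℚ.↧ₙ ε < suc k * suc k →
              ℚ.∣ ((+ p) ℚ./ (suc k * suc k)) ℚ.- (+ 9) / 2 ∣ ℚ.< ε
ratio-close p k {c} (mkℚ (+ zero) _ _) (ℚ.*<* (+<+ ()))
ratio-close p k {c} (mkℚ (ℤ.-[1+ _ ]) _ _) (ℚ.*<* ())
ratio-close p k {c} ε@(mkℚ +[1+ a ] b-1 _) _ hi lo small = ℚ.toℚᵘ-cancel-<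
  (ℚᵘ.<-respˡ-≃ (ℚᵘ.≃-sym diff) (*<* (subst₂ ℤ._<_ (ℤ.pos-* ℤ.∣ num ∣ (suc b-1)) (ℤ.pos-* (suc a) (t² * 2)) (+<+ main))))
  where
  t² : ℕ
  t² = suc k * suc k

  num : ℤ.ℤ
  num = (+ p) ℤ.* (+ 2) ℤ.+ ℤ.-[1+ 8 ] ℤ.* (+ t²)

  x y : ℚᵘ.ℚᵘ
  -- `mkℚᵘ` stores the denominator minus one: `suc (k + k * suc k)` is t², and 1 stands for 2.
  x = mkℚᵘ (+ p) (k + k * suc k)
  y = mkℚᵘ (+ 9) 1

  diff : toℚᵘ ℚ.∣ ((+ p) ℚ./ t²) ℚ.- (+ 9) / 2 ∣ ℚᵘ.≃ ℚᵘ.∣ x ℚᵘ.- y ∣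
  diff = ℚᵘ.≃-trans (ℚ.toℚᵘ-homo-∣-∣ (((+ p) ℚ./ t²) ℚ.- (+ 9) / 2))
    (ℚᵘ.∣-∣-cong (ℚᵘ.≃-trans (ℚ.toℚᵘ-homo-+ ((+ p) ℚ./ t²) (ℚ.- ((+ 9) / 2)))
      (ℚᵘ.+-cong (ℚ.toℚᵘ-fromℚᵘ x) (ℚᵘ.≃-trans (ℚ.toℚᵘ-homo‿- ((+ 9) / 2)) (ℚᵘ.-‿cong (ℚ.toℚᵘ-fromℚᵘ y))))))

  numerator : ℤ.∣ num ∣ ≤ c
  numerator = subst (λ z → ℤ.∣ z ∣ ≤ c) (sym eq) (∣⊖∣-bound (2 * p) (9 * t²) hi lo)
    where
    eq : num ≡ 2 * p ⊖ 9 * t²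
    eq = trans (cong₂ ℤ._+_ (trans (sym (ℤ.pos-* p 2)) (cong +_ (*-comm p 2)))
                            (trans (sym (ℤ.neg-distribˡ-* (+ 9) (+ t²))) (cong ℤ.-_ (sym (ℤ.pos-* 9 t²)))))
               (ℤ.m-n≡m⊖n (2 * p) (9 * t²))

  -- The claim is |2p - 9t²| / (2t²) < ε. As the numerator of ε is at least 1, c times its
  -- denominator below t² is enough, even without the factor 2.
  main : ℤ.∣ num ∣ * suc b-1 < suc a * (t² * 2)
  main = ≤-<-trans (*-monoˡ-≤ (suc b-1) numerator) (<-≤-trans small
    (≤-trans (m≤m*n t² 2) (m≤n*m (t² * 2) (suc a))))

count-estimate : ∀ {P} → Counts P → ∀ j k → suc k < suc j * suc j * suc j → 1 ≤ j →
                 let t = suc k ; c = t * (689 * (j * j)) in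
                 2 * P t ≤ 9 * (t * t) + c × 9 * (t * t) ≤ 2 * P t + c
count-estimate {P} counts j k t<m³ 1≤j = upper , lower
  where
  open ≤-Reasoning
  t s : ℕ
  t = suc k
  s = slack (2 * suc j) (suc j * suc j)

  upper : 2 * P t ≤ 9 * (t * t) + t * (689 * (j * j))
  upper = begin
    2 * P t                                 ≤⟨ count-upper counts t ⟩
    suc (3 * t) * suc (suc (3 * t))         ≡⟨ expand t ⟩
    9 * (t * t) + (9 * t + 2 * 1)           ≤⟨ +-monoʳ-≤ (9 * (t * t)) (+-monoʳ-≤ (9 * t) (*-monoʳ-≤ 2 {1} {t} (s≤s z≤n))) ⟩
    9 * (t * t) + (9 * t + 2 * t)           ≡⟨ collect t ⟩
    9 * (t * t) + t * 11                    ≤⟨ +-monoʳ-≤ (9 * (t * t)) (*-monoʳ-≤ t (≤-trans (m≤n+m 11 (6 * s)) (slack-bound j 1≤j))) ⟩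
    9 * (t * t) + t * (689 * (j * j))       ∎
    where
    expand : ∀ t → suc (3 * t) * suc (suc (3 * t)) ≡ 9 * (t * t) + (9 * t + 2 * 1)
    expand = solve-∀
    collect : ∀ t → 9 * (t * t) + (9 * t + 2 * t) ≡ 9 * (t * t) + t * 11
    collect = solve-∀

  lower : 9 * (t * t) ≤ 2 * P t + t * (689 * (j * j))
  lower = begin
    9 * (t * t)                     ≤⟨ square-defect t s (count-lower counts (2 * suc j) (suc j * suc j) k
                                         (≤-trans (<⇒≤ t<m³) (core-large j)) (≤-trans (<⇒≤ t<m³) (latin-large j))) ⟩
    2 * P t + t * (6 * s)           ≤⟨ +-monoʳ-≤ (2 * P t) (*-monoʳ-≤ t (≤-trans (m≤m+n (6 * s) 11) (slack-bound j 1≤j))) ⟩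
    2 * P t + t * (689 * (j * j))   ∎

cube-cancel-< : ∀ a b → a * a * a < b * b * b → a < b
cube-cancel-< a b p with a <? b
... | yes q = q
... | no ¬q = ⊥-elim (<⇒≱ p (*-mono-≤ (*-mono-≤ b≤a b≤a) b≤a))
  where b≤a = ≮⇒≥ ¬q

theorem5p9 : (P : ℕ → ℕ) → Counts P → ConvergesTo (ratio P) ((+ 9) / 2)
theorem5p9 P counts ε 0<ε = B * B * B , λ k N≤k → close k N≤k (cube-root (suc k))
  where
  b B : ℕ
  b = ℚ.↧ₙ ε
  -- If k ≥ B³, then the integer cube root j of t satisfies j ≥ B > 689b, so the error t · 689j²
  -- times b stays below t · j³ ≤ t².
  B = suc (689 * b)

  close : ∀ k → B * B * B ≤ k → (∃ λ j → j * j * j ≤ suc k × suc k < suc j * suc j * suc j) →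
          ℚ.∣ ratio P k ℚ.- (+ 9) / 2 ∣ ℚ.< ε
  close k N≤k (j , j³≤t , t<m³) =
    let hi , lo = count-estimate counts j k t<m³ (≤-trans (s≤s z≤n) B≤j)
    in ratio-close (P (suc k)) k ε 0<ε hi lo small
    where
    open ≤-Reasoning
    t : ℕ
    t = suc k

    B≤j : B ≤ j
    B≤j = s≤s⁻¹ (cube-cancel-< B (suc j) (≤-<-trans N≤k (<-trans (n<1+n k) t<m³)))

    0<j² : 0 < j * j
    0<j² = *-mono-≤ {1} {j} {1} {j} (≤-trans (s≤s z≤n) B≤j) (≤-trans (s≤s z≤n) B≤j)

    small : t * (689 * (j * j)) * b < t * t
    small = begin-strict
      t * (689 * (j * j)) * b    ≡⟨ shape t (j * j) b ⟩
      t * (j * j * (689 * b))    <⟨ *-monoʳ-< t (*-monoʳ-< (j * j) {{ℕ.>-nonZero 0<j²}} B≤j) ⟩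
      t * (j * j * j)            ≤⟨ *-monoʳ-≤ t j³≤t ⟩
      t * t                      ∎
      where
      shape : ∀ t q b → t * (689 * q) * b ≡ t * (q * (689 * b))
      shape = solve-∀
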